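{- Let $1\leq r<n$. There is a bijection $\phi:\mathfrak{S}_{n-1}\times\{0,1,\dots,n-1\}\to\mathfrak{S}_n$ such that for all $\pi\in\mathfrak{S}_{n-1}$ and $0\leq c\leq n-1$, $$\mathrm{exc}_r(\phi(\pi,c))=\begin{cases}\mathrm{exc}_r(\pi) & \text{if } 0\leq c\leq \mathrm{exc}_r(\pi)+r-1,\\ \mathrm{exc}_r(\pi)+1 & \text{otherwise},\end{cases}$$ and $\mathrm{den}_r(\phi(\pi,c))=\mathrm{den}_r(\pi)+c$.
   Context: $\mathfrak{S}_m$ is the set of permutations of $[m]$, written $\pi=\pi_1\cdots\pi_m$. For a word $w$ of distinct integers, $\mathrm{inv}(w)$ is the number of pairs of positions $i<j$ with $w_i>w_j$. For $\pi\in\mathfrak{S}_m$: an index $i$ is an $r$-level excedance place of $\pi$ if $\pi_i>i$ and $\pi_i\geq r$. $\mathrm{Excp}_r(\pi)$ is the set of $r$-level excedance places and $\mathrm{Nexcp}_r(\pi)$ its complement in $[m]$; $\mathrm{Exc}_r(\pi)$ (resp. $\mathrm{Nexc}_r(\pi)$) is the word of values $\pi_i$ for $i$ in $\mathrm{Excp}_r(\pi)$ (resp. $\mathrm{Nexcp}_r(\pi)$) read in increasing order of $i$. $\mathrm{den}_r(\pi)=\sum_{i\in\mathrm{Excp}_r(\pi)} i+\mathrm{inv}(\mathrm{Exc}_r(\pi))+\mathrm{inv}(\mathrm{Nexc}_r(\pi))$ and $\mathrm{exc}_r(\pi)=|\{i: \pi_i>i\geq r\}|$. -}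

module Defs where

open import Data.Nat using (ℕ; zero; suc; _+_; _<ᵇ_; _≤ᵇ_)
open import Data.Bool using (Bool; true; false; _∧_; not; if_then_else_)
open import Data.Fin using (Fin; toℕ)
open import Data.List using (List; []; _∷_; map; length; allFin; filterᵇ)
open import Data.Nat.ListAction using (sum)
open import Data.Fin.Permutation using (Permutation′; _⟨$⟩ʳ_)

-- A permutation π ∈ 𝔖_m is a bijection Fin m ↔ Fin m; position i (1-based) is
-- toℕ j + 1 for j : Fin m, and the value π_i is toℕ (π ⟨$⟩ʳ j) + 1.

pos : {m : ℕ} → Fin m → ℕ
pos j = suc (toℕ j)

val : {m : ℕ} → Permutation′ m → Fin m → ℕ
val π j = suc (toℕ (π ⟨$⟩ʳ j))

inv : List ℕ → ℕ
inv [] = 0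
inv (x ∷ w) = length (filterᵇ (λ y → y <ᵇ x) w) + inv w

isExcp : {m : ℕ} → ℕ → Permutation′ m → Fin m → Bool
isExcp r π j = (pos j <ᵇ val π j) ∧ (r ≤ᵇ val π j)

Excp : {m : ℕ} → ℕ → Permutation′ m → List (Fin m)
Excp {m} r π = filterᵇ (isExcp r π) (allFin m)

Nexcp : {m : ℕ} → ℕ → Permutation′ m → List (Fin m)
Nexcp {m} r π = filterᵇ (λ j → not (isExcp r π j)) (allFin m)

Exc : {m : ℕ} → ℕ → Permutation′ m → List ℕ
Exc r π = map (val π) (Excp r π)

Nexc : {m : ℕ} → ℕ → Permutation′ m → List ℕ
Nexc r π = map (val π) (Nexcp r π)

den : {m : ℕ} → ℕ → Permutation′ m → ℕ
den r π = sum (map pos (Excp r π)) + inv (Exc r π) + inv (Nexc r π)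

exc : {m : ℕ} → ℕ → Permutation′ m → ℕ
exc {m} r π = length (filterᵇ (λ j → (pos j <ᵇ val π j) ∧ (r ≤ᵇ pos j)) (allFin m))

{-# OPTIONS --safe #-}

-- Declare the letters of Nexc_r larger than those of Exc_r. Then den_r π is k(k+1)/2 plus the number
-- of inversions of π, where k is the number of r-level excedance places.
--
-- Let E consist of the r-level excedance letters of π and n. For x ≥ r, insert at place x the least
-- letter of E that is ≥ x, and replace each excedance letter ≥ x by the next letter of E. If x ∈ E
-- this creates a fixed point, preserves exc_r and adds #{v ∈ E : v > x} to den_r; otherwise it creates
-- an excedance place ≥ r and adds x − 1 + #{v ∈ E : v > x}. For q < r, insert at place r, then move
-- the letter a of place q to place r and relabel the places before r in an order-preserving way; this
-- adds to den_r the size of E plus the number of letters before place r that are declared larger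
-- than a, and it raises exc_r exactly if a ∈ E. For fixed π these increments are 0, …, n − 1, each
-- once, and the inserted place can be read off the result, so a count of permutations gives a
-- bijection.
module Submission where

open import Defs
open import Data.Bool using (Bool; true; false; T; T?; not; _∧_)
open import Data.Bool.Properties using (T-∧)
open import Data.Empty using (⊥-elim)
open import Data.Fin using (Fin; zero; suc; toℕ; fromℕ; fromℕ<; punchIn; punchOut; combine; remQuot)
  renaming (_<_ to _<ᶠ_; _≤_ to _≤ᶠ_)
import Data.Fin.Properties as Fin
open import Data.Fin.Permutation as Perm using (Permutation′; _≈_; _⟨$⟩ʳ_; _⟨$⟩ˡ_; insert; remove)
open import Data.List using (map; length; filterᵇ; tabulate)
open import Data.Nat using (ℕ; zero; suc; _+_; _∸_; _*_; _≤_; _<_; _<ᵇ_; _≤ᵇ_; z≤n; s≤s; s<s⁻¹; s≤s⁻¹; _!)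
import Data.Nat.Properties as ℕ
open import Data.Nat.ListAction using () renaming (sum to listSum)
open import Data.Nat.Solver using (module +-*-Solver)
open import Data.Product using (_×_; Σ; ∃; _,_; proj₁; proj₂)
open import Data.Sum using (_⊎_; inj₁; inj₂; [_,_])
open import Data.Unit using (tt)
open import Function using (_∘_; Injective; Equivalence)
open import Relation.Binary.Definitions using (tri<; tri≈; tri>)
open import Relation.Binary.PropositionalEquality
  using (_≡_; _≢_; refl; sym; trans; cong; cong₂; subst; subst₂; module ≡-Reasoning)
open import Relation.Nullary using (Dec; yes; no; ¬_; contradiction; _×-dec_; _⊎-dec_; ¬?)
open import Relation.Nullary.Decidable using (toSum)
open import Algebra.Properties.CommutativeMonoid.Sum ℕ.+-0-commutativeMonoid
  using (sum; sum-cong-≗; sum-remove; sum-permute; ∑-distrib-+)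

-- Places below r are the obstacle. A plain insertion there pushes the letter of place r - 1 to
-- place r, where exc_r starts to see it, so exc_r would rise for every such place or for none. But
-- these places are to supply the increments #E, ..., #E + r - 2. If e is the number of r-level
-- excedance places of π below r, then #E = exc_r π + 1 + e, so the threshold exc_r π + r - 1 asks
-- for exactly the e largest of these increments to raise exc_r. Hence the letter that lands at
-- place r has to be chosen. Insertion at r leaves e letters of E before place r. As letters of E
-- are declared small, these e letters have the most larger letters among the places before r.
-- Choosing one of them as `a` yields one of the e largest increments, and it makes place r an
-- excedance place.

private variable
  n : ℕ

-- Counting

χ : {A : Set} → Dec A → ℕ
χ (yes _) = 1
χ (no  _) = 0

χ-yes : {A : Set} (a? : Dec A) → A → χ a? ≡ 1
χ-yes (yes _) _ = refl
χ-yes (no ¬a) a = contradiction a ¬a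

χ-no : {A : Set} (a? : Dec A) → ¬ A → χ a? ≡ 0
χ-no (yes a) ¬a = contradiction a ¬a
χ-no (no _)  _  = refl

χ-cong : {A B : Set} (a? : Dec A) (b? : Dec B) → (A → B) → (B → A) → χ a? ≡ χ b?
χ-cong (yes a) b? f g = sym (χ-yes b? (f a))
χ-cong (no ¬a) b? f g = sym (χ-no b? (¬a ∘ g))

opaque
  count : {P : Fin n → Set} → (∀ i → Dec (P i)) → ℕ
  count P? = sum (λ i → χ (P? i))

opaque
  unfolding count

  count-cong : {P Q : Fin n → Set} (P? : ∀ i → Dec (P i)) (Q? : ∀ i → Dec (Q i)) →
               (∀ i → P i → Q i) → (∀ i → Q i → P i) → count P? ≡ count Q?
  count-cong P? Q? f g = sum-cong-≗ (λ i → χ-cong (P? i) (Q? i) (f i) (g i))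

  count-none : {P : Fin n → Set} (P? : ∀ i → Dec (P i)) → (∀ i → ¬ P i) → count P? ≡ 0
  count-none {zero}  P? ¬P = refl
  count-none {suc n} P? ¬P = cong₂ _+_ (χ-no (P? zero) (¬P zero)) (count-none (P? ∘ suc) (¬P ∘ suc))

  count-⊎ : {P Q R : Fin n → Set} (P? : ∀ i → Dec (P i)) (Q? : ∀ i → Dec (Q i)) (R? : ∀ i → Dec (R i)) →
            (∀ i → R i → P i ⊎ Q i) → (∀ i → P i → R i) → (∀ i → Q i → R i) →
            (∀ i → P i → ¬ Q i) → count R? ≡ count P? + count Q?
  count-⊎ P? Q? R? R⇒ P⇒R Q⇒R P⇒¬Q =
    trans (sum-cong-≗ pointwise) (∑-distrib-+ (χ ∘ P?) (χ ∘ Q?))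
    where
    pointwise : ∀ i → χ (R? i) ≡ χ (P? i) + χ (Q? i)
    pointwise i with P? i | Q? i
    ... | yes p | yes q = contradiction q (P⇒¬Q i p)
    ... | yes p | no _  = χ-yes (R? i) (P⇒R i p)
    ... | no _  | yes q = χ-yes (R? i) (Q⇒R i q)
    ... | no ¬p | no ¬q = χ-no (R? i) λ r → [ ¬p , ¬q ] (R⇒ i r)

  count-mono : {P Q : Fin n → Set} (P? : ∀ i → Dec (P i)) (Q? : ∀ i → Dec (Q i)) →
               (∀ i → P i → Q i) → count P? ≤ count Q?
  count-mono {zero}  P? Q? f = z≤n
  count-mono {suc n} P? Q? f = ℕ.+-mono-≤ (χ-mono (P? zero) (Q? zero) (f zero))
                                          (count-mono (P? ∘ suc) (Q? ∘ suc) (f ∘ suc))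
    where
    χ-mono : {A B : Set} (a? : Dec A) (b? : Dec B) → (A → B) → χ a? ≤ χ b?
    χ-mono (yes a) b? f = ℕ.≤-reflexive (sym (χ-yes b? (f a)))
    χ-mono (no _)  b? f = z≤n

  count-remove : {P : Fin (suc n) → Set} (P? : ∀ i → Dec (P i)) (x : Fin (suc n)) →
                 count P? ≡ χ (P? x) + count (λ i → P? (punchIn x i))
  count-remove P? x = sum-remove {i = x} (χ ∘ P?)

  count-permute : {P : Fin n → Set} (P? : ∀ i → Dec (P i)) (π : Permutation′ n) →
                  count P? ≡ count (λ i → P? (π ⟨$⟩ʳ i))
  count-permute P? π = sum-permute (χ ∘ P?) π

  count-toℕ< : ∀ {n} b → b ≤ n → count {n} (λ i → toℕ i ℕ.<? b) ≡ b
  count-toℕ< {n} zero b≤n = count-none {n} (λ i → toℕ i ℕ.<? zero) (λ i ())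
  count-toℕ< {suc n} (suc b) (s≤s b≤n) = cong suc (trans
    (count-cong {n} (λ i → toℕ (Fin.suc i) ℕ.<? suc b) (λ i → toℕ i ℕ.<? b) (λ i → s<s⁻¹) (λ i → s≤s))
    (count-toℕ< b b≤n))

count-remove-yes : {P : Fin (suc n) → Set} (P? : ∀ i → Dec (P i)) (x : Fin (suc n)) → P x →
                   count P? ≡ suc (count (λ i → P? (punchIn x i)))
count-remove-yes P? x px = trans (count-remove P? x) (cong (_+ count (λ i → P? (punchIn x i))) (χ-yes (P? x) px))

count-remove-no : {P : Fin (suc n) → Set} (P? : ∀ i → Dec (P i)) (x : Fin (suc n)) → ¬ P x →
                  count P? ≡ count (λ i → P? (punchIn x i))
count-remove-no P? x ¬px = trans (count-remove P? x) (cong (_+ count (λ i → P? (punchIn x i))) (χ-no (P? x) ¬px))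

count-mono-< : {P Q : Fin n → Set} (P? : ∀ i → Dec (P i)) (Q? : ∀ i → Dec (Q i)) →
               (∀ i → P i → Q i) → ∀ x → Q x → ¬ P x → count P? < count Q?
count-mono-< {suc n} P? Q? f x qx ¬px = begin-strict
  count P?                          ≡⟨ count-remove-no P? x ¬px ⟩
  count (λ i → P? (punchIn x i))    <⟨ s≤s (count-mono (λ i → P? (punchIn x i)) (λ i → Q? (punchIn x i)) (λ i → f (punchIn x i))) ⟩
  suc (count (λ i → Q? (punchIn x i))) ≡⟨ count-remove-yes Q? x qx ⟨
  count Q? ∎
  where
  open ℕ.≤-Reasoning

count-< : ∀ {n} (x : Fin n) → count (λ i → i Fin.<? x) ≡ toℕ x
count-< x = count-toℕ< (toℕ x) (ℕ.<⇒≤ (Fin.toℕ<n x))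

-- Finite injections and enumeration of permutations

injective⇒surjective : {f : Fin n → Fin n} → Injective _≡_ _≡_ f → ∀ y → ∃ λ x → f x ≡ y
injective⇒surjective {suc n} {f} inj y with Fin.any? (λ x → f x Fin.≟ y)
... | yes found = found
... | no  ¬∃    = contradiction (Fin.injective⇒≤ {f = g} g-injective) ℕ.1+n≰n
  where
  y≢f : ∀ x → y ≢ f x
  y≢f x y≡fx = ¬∃ (x , sym y≡fx)
  g : Fin (suc n) → Fin n
  g x = punchOut (y≢f x)
  g-injective : Injective _≡_ _≡_ g
  g-injective eq = inj (Fin.punchOut-injective (y≢f _) (y≢f _) eq)

injective⇒permutation : (f : Fin n → Fin n) → Injective _≡_ _≡_ f → Permutation′ n
injective⇒permutation f inj = Perm.permutation f (proj₁ ∘ surj) (proj₂ ∘ surj)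
                                (λ x → inj (proj₂ (surj (f x))))
  where surj = injective⇒surjective inj

⟨$⟩ʳ-injective : (π : Permutation′ n) → Injective _≡_ _≡_ (π ⟨$⟩ʳ_)
⟨$⟩ʳ-injective π {i} {j} eq =
  trans (sym (Perm.inverseˡ π)) (trans (cong (π ⟨$⟩ˡ_) eq) (Perm.inverseˡ π))

insert-self : ∀ i j (π : Permutation′ n) → insert i j π ⟨$⟩ʳ i ≡ j
insert-self i j π with i Fin.≟ i
... | yes _  = refl
... | no i≢i = contradiction refl i≢i

insert-cong : ∀ i j (π ρ : Permutation′ n) → π ≈ ρ → insert i j π ≈ insert i j ρ
insert-cong i j π ρ π≈ρ k with i Fin.≟ k
... | yes _ = refl
... | no  _ = cong (punchIn j) (π≈ρ _)

decode : Fin (n !) → Permutation′ n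
decode {zero}  _ = Perm.id
decode {suc n} c = insert zero (proj₁ (remQuot {suc n} (n !) c)) (decode (proj₂ (remQuot {suc n} (n !) c)))

encode : Permutation′ n → Fin (n !)
encode {zero}  π = zero
encode {suc n} π = combine (π ⟨$⟩ʳ zero) (encode (remove zero π))

decode-encode : (π : Permutation′ n) → decode (encode π) ≈ π
decode-encode {suc n} π i = begin
  decode (combine v c) ⟨$⟩ʳ i
    ≡⟨ cong (λ p → insert zero (proj₁ p) (decode (proj₂ p)) ⟨$⟩ʳ i) (Fin.remQuot-combine v c) ⟩
  insert zero v (decode c) ⟨$⟩ʳ i
    ≡⟨ insert-cong zero v (decode c) (remove zero π) (decode-encode (remove zero π)) i ⟩
  insert zero v (remove zero π) ⟨$⟩ʳ i
    ≡⟨ Perm.insert-remove zero π i ⟩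
  π ⟨$⟩ʳ i ∎
  where
  open ≡-Reasoning
  v = π ⟨$⟩ʳ zero
  c = encode (remove zero π)

remove-cong : (π ρ : Permutation′ (suc n)) → π ≈ ρ → remove zero π ≈ remove zero ρ
remove-cong π ρ π≈ρ i = Fin.punchIn-injective (π ⟨$⟩ʳ zero) _ _ (begin
  punchIn (π ⟨$⟩ʳ zero) (remove zero π ⟨$⟩ʳ i) ≡⟨ Perm.punchIn-permute π zero i ⟨
  π ⟨$⟩ʳ suc i                                 ≡⟨ π≈ρ (suc i) ⟩
  ρ ⟨$⟩ʳ suc i                                 ≡⟨ Perm.punchIn-permute ρ zero i ⟩
  punchIn (ρ ⟨$⟩ʳ zero) (remove zero ρ ⟨$⟩ʳ i) ≡⟨ cong (λ v → punchIn v (remove zero ρ ⟨$⟩ʳ i)) (π≈ρ zero) ⟨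
  punchIn (π ⟨$⟩ʳ zero) (remove zero ρ ⟨$⟩ʳ i) ∎)
  where
  open ≡-Reasoning

encode-cong : (π ρ : Permutation′ n) → π ≈ ρ → encode π ≡ encode ρ
encode-cong {zero}  π ρ π≈ρ = refl
encode-cong {suc n} π ρ π≈ρ = cong₂ combine (π≈ρ zero)
  (encode-cong (remove zero π) (remove zero ρ) (remove-cong π ρ π≈ρ))

encode-decode : (c : Fin (n !)) → encode (decode {n} c) ≡ c
encode-decode {zero} zero = refl
encode-decode {suc n} c = begin
  combine (insert zero v (decode c′) ⟨$⟩ʳ zero) (encode (remove zero (insert zero v (decode c′))))
    ≡⟨ cong₂ combine (insert-self zero v (decode c′))
         (encode-cong (remove zero (insert zero v (decode c′))) (decode c′) (Perm.remove-insert zero v (decode c′))) ⟩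
  combine v (encode (decode {n} c′)) ≡⟨ cong (combine v) (encode-decode {n} c′) ⟩
  combine v c′                       ≡⟨ Fin.combine-remQuot {suc n} (n !) c ⟩
  c                                  ∎
  where
  open ≡-Reasoning
  v = proj₁ (remQuot {suc n} (n !) c)
  c′ = proj₂ (remQuot {suc n} (n !) c)

-- Permutations are compared by `≈`, so the pigeonhole argument runs on codes. Since `suc n !`
-- unfolds to `suc n * n !`, a pair of a place and a coded permutation is an element of
-- `Fin (suc n !)`, and `Φ` becomes an injective self-map of this finite set.
insertion-surjective : (Φ : Permutation′ n → Fin (suc n) → Permutation′ (suc n)) →
  (∀ π ρ x y → Φ π x ≈ Φ ρ y → π ≈ ρ × x ≡ y) →
  ∀ σ → Σ (Permutation′ n) λ π → Σ (Fin (suc n)) λ x → Φ π x ≈ σ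
insertion-surjective {n} Φ Φ-injective σ = decode c , x , λ i → begin
  Φ (decode c) x ⟨$⟩ʳ i                     ≡⟨ decode-encode (Φ (decode c) x) i ⟨
  decode (encode (Φ (decode c) x)) ⟨$⟩ʳ i   ≡⟨ cong (λ c → decode c ⟨$⟩ʳ i) (proj₂ preimage) ⟩
  decode (encode σ) ⟨$⟩ʳ i                  ≡⟨ decode-encode σ i ⟩
  σ ⟨$⟩ʳ i                                  ∎
  where
  open ≡-Reasoning
  image : Fin (suc n) × Fin (n !) → Permutation′ (suc n)
  image (x , c) = Φ (decode c) x
  f : Fin (suc n !) → Fin (suc n !)
  f = encode ∘ image ∘ remQuot (n !)
  image-injective : ∀ p q → image p ≈ image q → p ≡ q
  image-injective (x , c) (y , d) eq with Φ-injective (decode c) (decode d) x y eq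
  ... | π≈ρ , x≡y = cong₂ _,_ x≡y (begin
    c                 ≡⟨ encode-decode {n} c ⟨
    encode (decode {n} c) ≡⟨ encode-cong (decode c) (decode d) π≈ρ ⟩
    encode (decode {n} d) ≡⟨ encode-decode {n} d ⟩
    d                 ∎)
  f-injective : Injective _≡_ _≡_ f
  f-injective {a} {b} eq = begin
    a ≡⟨ Fin.combine-remQuot {suc n} (n !) a ⟨
    combine (proj₁ (remQuot (n !) a)) (proj₂ (remQuot {suc n} (n !) a))
      ≡⟨ cong (λ p → combine (proj₁ p) (proj₂ p)) (image-injective (remQuot (n !) a) (remQuot (n !) b) (λ i → begin
           image (remQuot (n !) a) ⟨$⟩ʳ i ≡⟨ decode-encode (image (remQuot (n !) a)) i ⟨
           decode (f a) ⟨$⟩ʳ i            ≡⟨ cong (λ c → decode c ⟨$⟩ʳ i) eq ⟩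
           decode (f b) ⟨$⟩ʳ i            ≡⟨ decode-encode (image (remQuot (n !) b)) i ⟩
           image (remQuot (n !) b) ⟨$⟩ʳ i ∎)) ⟩
    combine (proj₁ (remQuot (n !) b)) (proj₂ (remQuot {suc n} (n !) b))
      ≡⟨ Fin.combine-remQuot {suc n} (n !) b ⟩
    b ∎
  preimage = injective⇒surjective f-injective (encode σ)
  x = proj₁ (remQuot {suc n} (n !) (proj₁ preimage))
  c = proj₂ (remQuot {suc n} (n !) (proj₁ preimage))

-- Rotations

least : {P : Fin n → Set} (P? : ∀ i → Dec (P i)) (K : Fin n → ℕ) →
        (∃ λ v → P v × (∀ u → P u → K v ≤ K u)) ⊎ (∀ u → ¬ P u)
least {zero}  P? K = inj₂ λ ()
least {suc n} P? K with P? zero | least (P? ∘ suc) (K ∘ suc)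
... | no ¬p | inj₂ none = inj₂ λ { zero → ¬p ; (suc u) → none u }
... | no ¬p | inj₁ (v , pv , min) =
  inj₁ (suc v , pv , λ { zero p → contradiction p ¬p ; (suc u) → min u })
... | yes p | inj₂ none =
  inj₁ (zero , p , λ { zero _ → ℕ.≤-refl ; (suc u) pu → contradiction pu (none u) })
... | yes p | inj₁ (v , pv , min) with ℕ.≤-total (K zero) (K (suc v))
...   | inj₁ k≤ = inj₁ (zero , p , λ { zero _ → ℕ.≤-refl ; (suc u) pu → ℕ.≤-trans k≤ (min u pu) })
...   | inj₂ k≥ = inj₁ (suc v , pv , λ { zero _ → k≥ ; (suc u) → min u })

-- The graph of the cyclic rotation of S that sends each element to the one with the next
-- larger key, and the element t of largest key to the one of smallest key.
data Rotates {n} (S : Fin n → Set) (K : Fin n → ℕ) (t v w : Fin n) : Set where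
  wraps : v ≡ t → S w → (∀ u → S u → K w ≤ K u) → Rotates S K t v w
  steps : v ≢ t → S v → S w → K v < K w → (∀ u → S u → K v < K u → K w ≤ K u) → Rotates S K t v w
  fixes : ¬ S v → w ≡ v → Rotates S K t v w

module Rotation {n} {S : Fin n → Set} (S? : ∀ i → Dec (S i))
                {K : Fin n → ℕ} (K-injective : Injective _≡_ _≡_ K)
                {t : Fin n} (t∈S : S t) (t-max : ∀ u → S u → K u ≤ K t) where

  rotate : ∀ v → ∃ (Rotates S K t v)
  rotate v with v Fin.≟ t
  rotate v | yes v≡t with least S? K
  ... | inj₁ (w , w∈S , min) = w , wraps v≡t w∈S min
  ... | inj₂ none            = contradiction t∈S (none t)
  rotate v | no v≢t with S? v
  ... | no v∉S = v , fixes v∉S refl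
  ... | yes v∈S with least (λ u → S? u ×-dec K v ℕ.<? K u) K
  ...   | inj₁ (w , (w∈S , v<w) , min) = w , steps v≢t v∈S w∈S v<w (λ u u∈S v<u → min u (u∈S , v<u))
  ...   | inj₂ none = contradiction (t∈S , ℕ.≤∧≢⇒< (t-max v v∈S) (v≢t ∘ K-injective)) (none t)

  Rotates-injective : ∀ {v v′ w} → Rotates S K t v w → Rotates S K t v′ w → v ≡ v′
  Rotates-injective (wraps refl _ _) (wraps refl _ _) = refl
  Rotates-injective (wraps _ _ min) (steps _ v′∈S _ v′<w _) = contradiction v′<w (ℕ.≤⇒≯ (min _ v′∈S))
  Rotates-injective (wraps _ w∈S _) (fixes w∉S refl) = contradiction w∈S w∉S
  Rotates-injective (steps _ v∈S _ v<w _) (wraps _ _ min) = contradiction v<w (ℕ.≤⇒≯ (min _ v∈S))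
  Rotates-injective {v} {v′} (steps _ v∈S _ v<w next) (steps _ v′∈S _ v′<w next′) with ℕ.<-cmp (K v) (K v′)
  ... | tri< v<v′ _ _ = contradiction v′<w (ℕ.≤⇒≯ (next _ v′∈S v<v′))
  ... | tri≈ _ v≡v′ _ = K-injective v≡v′
  ... | tri> _ _ v′<v = contradiction v<w (ℕ.≤⇒≯ (next′ _ v∈S v′<v))
  Rotates-injective (steps _ _ w∈S _ _) (fixes w∉S refl) = contradiction w∈S w∉S
  Rotates-injective (fixes w∉S refl) (wraps _ w∈S _) = contradiction w∈S w∉S
  Rotates-injective (fixes w∉S refl) (steps _ _ w∈S _ _) = contradiction w∈S w∉S
  Rotates-injective (fixes _ refl) (fixes _ refl) = refl

  -- Insertion below r₀ applies the inverse of a rotation, so undoing that insertion rests on this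
  -- direction of the graph; undoing an insertion at x ≥ r₀ rests on `Rotates-injective`.
  Rotates-functional : ∀ {v w w′} → Rotates S K t v w → Rotates S K t v w′ → w ≡ w′
  Rotates-functional (wraps _ w∈S min) (wraps _ w′∈S min′) = K-injective (ℕ.≤-antisym (min _ w′∈S) (min′ _ w∈S))
  Rotates-functional (wraps v≡t _ _) (steps v≢t _ _ _ _) = contradiction v≡t v≢t
  Rotates-functional (wraps refl _ _) (fixes t∉S _) = contradiction t∈S t∉S
  Rotates-functional (steps v≢t _ _ _ _) (wraps v≡t _ _) = contradiction v≡t v≢t
  Rotates-functional (steps _ _ w∈S v<w next) (steps _ _ w′∈S v<w′ next′) =
    K-injective (ℕ.≤-antisym (next _ w′∈S v<w′) (next′ _ w∈S v<w))
  Rotates-functional (steps _ v∈S _ _ _) (fixes v∉S _) = contradiction v∈S v∉S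
  Rotates-functional (fixes t∉S _) (wraps refl _ _) = contradiction t∈S t∉S
  Rotates-functional (fixes v∉S _) (steps _ v∈S _ _ _) = contradiction v∈S v∉S
  Rotates-functional (fixes _ refl) (fixes _ refl) = refl

  opaque
    rotation : Permutation′ n
    rotation = injective⇒permutation (proj₁ ∘ rotate) λ {v} {v′} eq →
      Rotates-injective (proj₂ (rotate v)) (subst (Rotates S K t v′) (sym eq) (proj₂ (rotate v′)))

    rotation-Rotates : ∀ v → Rotates S K t v (rotation ⟨$⟩ʳ v)
    rotation-Rotates = proj₂ ∘ rotate

-- Two permutations with the same insertion result give sets that are only logically equivalent and
-- keys that agree only pointwise; this carries the rotation of one over to the data of the other.
Rotates-resp : {S S′ : Fin n → Set} {K K′ : Fin n → ℕ} → (∀ v → S v → S′ v) → (∀ v → S′ v → S v) →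
               (∀ v → K v ≡ K′ v) → ∀ {t v w} → Rotates S K t v w → Rotates S′ K′ t v w
Rotates-resp f g K≗K′ (wraps v≡t w∈S min) = wraps v≡t (f _ w∈S) λ u u∈S′ →
  subst (_≤ _) (K≗K′ _) (subst (_ ≤_) (K≗K′ u) (min u (g u u∈S′)))
Rotates-resp f g K≗K′ (steps v≢t v∈S w∈S v<w next) = steps v≢t (f _ v∈S) (f _ w∈S)
  (subst (_< _) (K≗K′ _) (subst (_ <_) (K≗K′ _) v<w)) λ u u∈S′ v<u →
  subst (_≤ _) (K≗K′ _) (subst (_ ≤_) (K≗K′ u) (next u (g u u∈S′)
    (subst (_< _) (sym (K≗K′ _)) (subst (_ <_) (sym (K≗K′ u)) v<u))))
Rotates-resp f g K≗K′ (fixes v∉S w≡v) = fixes (v∉S ∘ g _) w≡v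

-- Inversions

Inversion : (Fin n → ℕ) → Fin n → Fin n → Set
Inversion w j i = toℕ i < toℕ j × w j < w i

inversion? : (w : Fin n → ℕ) (j i : Fin n) → Dec (Inversion w j i)
inversion? w j i = i Fin.<? j ×-dec w j ℕ.<? w i

column : (Fin n → ℕ) → Fin n → ℕ
column w j = count (inversion? w j)

opaque
  inversions : (Fin n → ℕ) → ℕ
  inversions w = sum (column w)

column-cong : {w w′ : Fin n → ℕ} (j : Fin n) →
              (∀ i → toℕ i < toℕ j → w j < w i → w′ j < w′ i) →
              (∀ i → toℕ i < toℕ j → w′ j < w′ i → w j < w i) → column w j ≡ column w′ j
column-cong {w = w} {w′} j f g = count-cong (inversion? w j) (inversion? w′ j)
  (λ i (i<j , lt) → i<j , f i i<j lt) (λ i (i<j , lt) → i<j , g i i<j lt)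

punchIn-mono-< : ∀ (x : Fin (suc n)) i j → toℕ i < toℕ j → toℕ (punchIn x i) < toℕ (punchIn x j)
punchIn-mono-< x i j i<j = ℕ.≰⇒> λ le → ℕ.<⇒≱ i<j (Fin.punchIn-cancel-≤ x j i le)

punchIn-cancel-< : ∀ (x : Fin (suc n)) i j → toℕ (punchIn x i) < toℕ (punchIn x j) → toℕ i < toℕ j
punchIn-cancel-< x i j lt = ℕ.≰⇒> λ le → ℕ.<⇒≱ lt (Fin.punchIn-mono-≤ x j i le)

opaque
  unfolding count inversions

  inversions-cong : {w w′ : Fin n → ℕ} → (∀ i j → w j < w i → w′ j < w′ i) →
                    (∀ i j → w′ j < w′ i → w j < w i) → inversions w ≡ inversions w′
  inversions-cong {w = w} {w′} f g = sum-cong-≗ λ j → column-cong {w = w} {w′} j (λ i _ → f i j) (λ i _ → g i j)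

  sum-χ : {P : Fin n → Set} (P? : ∀ i → Dec (P i)) → sum (λ i → χ (P? i)) ≡ count P?
  sum-χ P? = refl

  inversions-zero : (w : Fin 0 → ℕ) → inversions w ≡ 0
  inversions-zero w = refl

  inversions-remove : (w : Fin (suc n) → ℕ) (x : Fin (suc n)) →
    inversions w ≡ inversions (w ∘ punchIn x) + (column w x + count (λ j → inversion? w j x))
  inversions-remove w x = begin
    sum (column w)                                    ≡⟨ sum-remove {i = x} (column w) ⟩
    column w x + sum (column w ∘ punchIn x)           ≡⟨ cong (column w x +_) (sum-cong-≗ column-punchIn) ⟩
    column w x + sum (λ j → χ (inversion? w (punchIn x j) x) + column (w ∘ punchIn x) j)
      ≡⟨ cong (column w x +_) (∑-distrib-+ (λ j → χ (inversion? w (punchIn x j) x)) (column (w ∘ punchIn x))) ⟩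
    column w x + (sum (λ j → χ (inversion? w (punchIn x j) x)) + inversions (w ∘ punchIn x))
      ≡⟨ cong (λ c → column w x + (c + inversions (w ∘ punchIn x)))
           (trans (sum-χ (λ j → inversion? w (punchIn x j) x))
                  (sym (count-remove-no (λ j → inversion? w j x) x (ℕ.<-irrefl refl ∘ proj₁)))) ⟩
    column w x + (count (λ j → inversion? w j x) + inversions (w ∘ punchIn x))
      ≡⟨ solve 3 (λ a b c → a :+ (b :+ c) := c :+ (a :+ b)) refl (column w x) (count (λ j → inversion? w j x)) (inversions (w ∘ punchIn x)) ⟩
    inversions (w ∘ punchIn x) + (column w x + count (λ j → inversion? w j x)) ∎
    where
    open ≡-Reasoning
    open +-*-Solver
    column-punchIn : ∀ j → column w (punchIn x j) ≡
                           χ (inversion? w (punchIn x j) x) + column (w ∘ punchIn x) j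
    column-punchIn j = trans (count-remove (inversion? w (punchIn x j)) x)
      (cong (χ (inversion? w (punchIn x j) x) +_)
        (count-cong (λ i → inversion? w (punchIn x j) (punchIn x i)) (inversion? (w ∘ punchIn x) j)
          (λ i (lt , inv) → punchIn-cancel-< x i j lt , inv)
          (λ i (lt , inv) → punchIn-mono-< x i j lt , inv)))

  -- A difference of two inversion numbers written without subtraction. It serves to compare an
  -- insertion below r₀ with the insertion at r₀.
  inversions-change-column : {w w′ : Fin (suc n) → ℕ} (x : Fin (suc n)) →
    (∀ j → j ≢ x → column w j ≡ column w′ j) →
    inversions w + column w′ x ≡ inversions w′ + column w x
  inversions-change-column {w = w} {w′} x eq = begin
    sum (column w) + column w′ x
      ≡⟨ cong (_+ column w′ x) (sum-remove {i = x} (column w)) ⟩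
    column w x + sum (column w ∘ punchIn x) + column w′ x
      ≡⟨ cong (λ s → column w x + s + column w′ x)
           (sum-cong-≗ λ j → eq (punchIn x j) (Fin.punchInᵢ≢i x j)) ⟩
    column w x + sum (column w′ ∘ punchIn x) + column w′ x
      ≡⟨ solve 3 (λ a b c → a :+ b :+ c := c :+ b :+ a) refl (column w x) (sum (column w′ ∘ punchIn x)) (column w′ x) ⟩
    column w′ x + sum (column w′ ∘ punchIn x) + column w x
      ≡⟨ cong (_+ column w x) (sum-remove {i = x} (column w′)) ⟨
    sum (column w′) + column w x ∎
    where
    open ≡-Reasoning
    open +-*-Solver

-- The denominator as a number of inversions

triangle : ℕ → ℕ
triangle zero    = 0
triangle (suc k) = triangle k + suc k

-- With `N` above every letter, the order of keys is the declared one: by letter inside each class,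
-- and the whole first class below the second.
key : ℕ → {A : Set} → Dec A → ℕ → ℕ
key N (yes _) v = v
key N (no  _) v = N + v

key-yes : ∀ N {A : Set} (a? : Dec A) v → A → key N a? v ≡ v
key-yes N (yes _) v _ = refl
key-yes N (no ¬a) v a = contradiction a ¬a

key-no : ∀ N {A : Set} (a? : Dec A) v → ¬ A → key N a? v ≡ N + v
key-no N (yes a) v ¬a = contradiction a ¬a
key-no N (no _)  v _  = refl

length-filter : ∀ {m} {A : Set} (p : A → Bool) (F : Fin m → A) →
                length (filterᵇ p (tabulate F)) ≡ count (λ i → T? (p (F i)))
length-filter {zero}  p F = sym (count-none (λ i → T? (p (F i))) λ ())
length-filter {suc m} p F with p (F zero) in eq
... | true  = trans (cong suc (length-filter p (F ∘ suc)))
                    (sym (count-remove-yes (λ i → T? (p (F i))) zero (subst T (sym eq) tt)))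
... | false = trans (length-filter p (F ∘ suc))
                    (sym (count-remove-no (λ i → T? (p (F i))) zero (subst T eq)))

length-filter-map : ∀ {m} {A : Set} (p : A → Bool) (v : A → ℕ) (x : ℕ) (F : Fin m → A) →
  length (filterᵇ (_<ᵇ x) (map v (filterᵇ p (tabulate F)))) ≡
  count (λ i → T? (p (F i)) ×-dec v (F i) ℕ.<? x)
length-filter-map {zero}  p v x F = sym (count-none (λ i → T? (p (F i)) ×-dec v (F i) ℕ.<? x) λ ())
length-filter-map {suc m} p v x F with p (F zero) in eq
... | false = trans (length-filter-map p v x (F ∘ suc))
  (sym (count-remove-no (λ i → T? (p (F i)) ×-dec v (F i) ℕ.<? x) zero (subst T eq ∘ proj₁)))
... | true with v (F zero) <ᵇ x in lt
...   | true = trans (cong suc (length-filter-map p v x (F ∘ suc)))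
  (sym (count-remove-yes (λ i → T? (p (F i)) ×-dec v (F i) ℕ.<? x) zero
    (subst T (sym eq) tt , ℕ.<ᵇ⇒< _ _ (subst T (sym lt) tt))))
...   | false = trans (length-filter-map p v x (F ∘ suc))
  (sym (count-remove-no (λ i → T? (p (F i)) ×-dec v (F i) ℕ.<? x) zero
    λ (_ , v<x) → subst T lt (ℕ.<⇒<ᵇ v<x)))

inversions-suc : (w : Fin (suc n) → ℕ) →
                 inversions w ≡ count (λ j → w (suc j) ℕ.<? w zero) + inversions (w ∘ suc)
inversions-suc w = begin
  inversions w
    ≡⟨ inversions-remove w zero ⟩
  inversions (w ∘ suc) + (column w zero + count (λ j → inversion? w j zero))
    ≡⟨ cong (λ c → inversions (w ∘ suc) + (c + count (λ j → inversion? w j zero)))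
         (count-none (inversion? w zero) (λ _ ())) ⟩
  inversions (w ∘ suc) + count (λ j → inversion? w j zero)
    ≡⟨ cong (inversions (w ∘ suc) +_) (trans
         (count-remove-no (λ j → inversion? w j zero) zero λ ())
         (count-cong (λ j → inversion? w (suc j) zero) (λ j → w (suc j) ℕ.<? w zero)
           (λ _ → proj₂) (λ _ lt → s≤s z≤n , lt))) ⟩
  inversions (w ∘ suc) + count (λ j → w (suc j) ℕ.<? w zero)
    ≡⟨ ℕ.+-comm (inversions (w ∘ suc)) _ ⟩
  count (λ j → w (suc j) ℕ.<? w zero) + inversions (w ∘ suc) ∎
  where
  open ≡-Reasoning

-- A place i contributes i = 1 + #{excedance places before i} + #{other places before i}. The first
-- two parts sum to a triangular number; the last counts the inversions that appear between the
-- two subwords once the excedance letters are declared smaller than all the others.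
den-tabulate : ∀ {m} {A : Set} (N : ℕ) (p : A → Bool) (v : A → ℕ) → (∀ a b → v a < N + v b) →
  (q : A → ℕ) (s : ℕ) (F : Fin m → A) → (∀ i → q (F i) ≡ suc (s + toℕ i)) →
  listSum (map q (filterᵇ p (tabulate F))) + inv (map v (filterᵇ p (tabulate F)))
    + inv (map v (filterᵇ (not ∘ p) (tabulate F)))
  ≡ s * count (λ i → T? (p (F i))) + triangle (count (λ i → T? (p (F i))))
    + inversions (λ i → key N (T? (p (F i))) (v (F i)))
den-tabulate {zero} N p v v< q s F q≡
  rewrite count-none (λ i → T? (p (F i))) (λ ()) | ℕ.*-zeroʳ s = sym (inversions-zero _)
den-tabulate {suc m} N p v v< q s F q≡ with p (F zero) in eq
... | true = begin
  q (F zero) + places + (inv-row + exc-inv) + non-inv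
    ≡⟨ solve 5 (λ a b c d e → a :+ b :+ (c :+ d) :+ e := a :+ c :+ (b :+ d :+ e)) refl
         (q (F zero)) places inv-row exc-inv non-inv ⟩
  q (F zero) + inv-row + (places + exc-inv + non-inv)
    ≡⟨ cong₂ (λ a b → a + b + (places + exc-inv + non-inv)) (trans (q≡ zero) (cong suc (ℕ.+-identityʳ s)))
         (trans (length-filter-map p v (v (F zero)) (F ∘ suc)) (count-cong _ (λ j → K (suc j) ℕ.<? K zero) to from)) ⟩
  suc s + row + (places + exc-inv + non-inv)
    ≡⟨ cong (suc s + row +_) (den-tabulate N p v v< q (suc s) (F ∘ suc) (λ i → trans (q≡ (suc i)) (cong suc (ℕ.+-suc s (toℕ i))))) ⟩
  suc s + row + (suc s * k + triangle k + inversions (K ∘ suc))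
    ≡⟨ solve 5 (λ s r k t i → con 1 :+ s :+ r :+ ((con 1 :+ s) :* k :+ t :+ i) :=
         s :* (con 1 :+ k) :+ (t :+ (con 1 :+ k)) :+ (r :+ i)) refl s row k (triangle k) (inversions (K ∘ suc)) ⟩
  -- The head contributes `suc s`, and the offset `suc s` of the tail leaves a surplus `k`; together
  -- they are `s` and the next summand `suc k` of the triangle.
  s * suc k + triangle (suc k) + (row + inversions (K ∘ suc))
    ≡⟨ cong₂ (λ a b → s * a + triangle a + b)
         (sym (count-remove-yes (λ i → T? (p (F i))) zero T₀)) (sym (inversions-suc K)) ⟩
  s * count (λ i → T? (p (F i))) + triangle (count (λ i → T? (p (F i)))) + inversions K ∎
  where
  open ≡-Reasoning
  open +-*-Solver
  K : Fin (suc m) → ℕ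
  K i = key N (T? (p (F i))) (v (F i))
  k = count (λ i → T? (p (F (suc i))))
  places = listSum (map q (filterᵇ p (tabulate (F ∘ suc))))
  exc-inv = inv (map v (filterᵇ p (tabulate (F ∘ suc))))
  non-inv = inv (map v (filterᵇ (not ∘ p) (tabulate (F ∘ suc))))
  inv-row = length (filterᵇ (_<ᵇ v (F zero)) (map v (filterᵇ p (tabulate (F ∘ suc)))))
  row = count (λ j → K (suc j) ℕ.<? K zero)
  T₀ : T (p (F zero))
  T₀ = subst T (sym eq) tt
  K₀ : K zero ≡ v (F zero)
  K₀ = key-yes N (T? (p (F zero))) _ T₀
  to : ∀ j → T (p (F (suc j))) × v (F (suc j)) < v (F zero) → K (suc j) < K zero
  to j (Tj , lt) rewrite K₀ | key-yes N (T? (p (F (suc j)))) (v (F (suc j))) Tj = lt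
  from : ∀ j → K (suc j) < K zero → T (p (F (suc j))) × v (F (suc j)) < v (F zero)
  from j lt rewrite K₀ with T? (p (F (suc j)))
  ... | yes Tj = Tj , lt
  ... | no _   = contradiction lt (ℕ.<-asym (v< (F zero) (F (suc j))))
... | false = begin
  places + exc-inv + (inv-row + non-inv)
    ≡⟨ solve 4 (λ a b c d → a :+ b :+ (c :+ d) := c :+ (a :+ b :+ d)) refl places exc-inv inv-row non-inv ⟩
  inv-row + (places + exc-inv + non-inv)
    ≡⟨ cong₂ _+_ (length-filter-map (not ∘ p) v (v (F zero)) (F ∘ suc))
         (den-tabulate N p v v< q (suc s) (F ∘ suc) (λ i → trans (q≡ (suc i)) (cong suc (ℕ.+-suc s (toℕ i))))) ⟩
  non-row + (suc s * k + triangle k + inversions (K ∘ suc))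
    ≡⟨ solve 5 (λ s r k t i → r :+ ((con 1 :+ s) :* k :+ t :+ i) :=
         s :* k :+ t :+ (k :+ r :+ i)) refl s non-row k (triangle k) (inversions (K ∘ suc)) ⟩
  -- The surplus `k` from the offset `suc s` is one unit for each later excedance letter. These are
  -- the inversions that the head, now declared large, makes with them.
  s * k + triangle k + (k + non-row + inversions (K ∘ suc))
    ≡⟨ cong (λ r → s * k + triangle k + (r + inversions (K ∘ suc)))
         (count-⊎ _ _ (λ j → K (suc j) ℕ.<? K zero) split exc< non< disjoint) ⟨
  s * k + triangle k + (row + inversions (K ∘ suc))
    ≡⟨ cong₂ (λ a b → s * a + triangle a + b)
         (sym (count-remove-no (λ i → T? (p (F i))) zero ¬T₀)) (sym (inversions-suc K)) ⟩
  s * count (λ i → T? (p (F i))) + triangle (count (λ i → T? (p (F i)))) + inversions K ∎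
  where
  open ≡-Reasoning
  open +-*-Solver
  K : Fin (suc m) → ℕ
  K i = key N (T? (p (F i))) (v (F i))
  k = count (λ i → T? (p (F (suc i))))
  places = listSum (map q (filterᵇ p (tabulate (F ∘ suc))))
  exc-inv = inv (map v (filterᵇ p (tabulate (F ∘ suc))))
  non-inv = inv (map v (filterᵇ (not ∘ p) (tabulate (F ∘ suc))))
  inv-row = length (filterᵇ (_<ᵇ v (F zero)) (map v (filterᵇ (not ∘ p) (tabulate (F ∘ suc)))))
  row = count (λ j → K (suc j) ℕ.<? K zero)
  non-row = count (λ j → T? (not (p (F (suc j)))) ×-dec v (F (suc j)) ℕ.<? v (F zero))
  ¬T₀ : ¬ T (p (F zero))
  ¬T₀ = subst T eq
  K₀ : K zero ≡ N + v (F zero)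
  K₀ = key-no N (T? (p (F zero))) _ ¬T₀
  ¬T-not : ∀ b → T b → ¬ T (not b)
  ¬T-not true _ ()
  T-not : ∀ b → ¬ T b → T (not b)
  T-not true  ¬T = ¬T tt
  T-not false _  = tt
  split : ∀ j → K (suc j) < K zero → T (p (F (suc j))) ⊎ (T (not (p (F (suc j)))) × v (F (suc j)) < v (F zero))
  split j lt rewrite K₀ with T? (p (F (suc j)))
  ... | yes Tj = inj₁ Tj
  ... | no ¬Tj = inj₂ (T-not _ ¬Tj , ℕ.+-cancelˡ-< N _ _ lt)
  exc< : ∀ j → T (p (F (suc j))) → K (suc j) < K zero
  exc< j Tj rewrite K₀ | key-yes N (T? (p (F (suc j)))) (v (F (suc j))) Tj = v< _ _
  non< : ∀ j → T (not (p (F (suc j)))) × v (F (suc j)) < v (F zero) → K (suc j) < K zero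
  non< j (Tj , lt) rewrite K₀ | key-no N (T? (p (F (suc j)))) (v (F (suc j))) (λ T → ¬T-not _ T Tj) =
    ℕ.+-monoʳ-< N lt
  disjoint : ∀ j → T (p (F (suc j))) → ¬ (T (not (p (F (suc j)))) × v (F (suc j)) < v (F zero))
  disjoint j Tj (T-not , _) = ¬T-not _ Tj T-not

-- Places and letters are counted from 0, so the level is r₀ = r − 1.
Excedance : ℕ → Permutation′ n → Fin n → Set
Excedance r₀ π j = toℕ j < toℕ (π ⟨$⟩ʳ j) × r₀ ≤ toℕ (π ⟨$⟩ʳ j)

T-isExcp : ∀ r₀ (π : Permutation′ n) j → T (isExcp (suc r₀) π j) → Excedance r₀ π j
T-isExcp r₀ π j t with lt , le ← Equivalence.to (T-∧ {pos j <ᵇ val π j}) t =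
  s<s⁻¹ (ℕ.<ᵇ⇒< _ _ lt) , s≤s⁻¹ (ℕ.≤ᵇ⇒≤ _ _ le)

isExcp-T : ∀ r₀ (π : Permutation′ n) j → Excedance r₀ π j → T (isExcp (suc r₀) π j)
isExcp-T r₀ π j (lt , le) =
  Equivalence.from (T-∧ {pos j <ᵇ val π j}) (ℕ.<⇒<ᵇ (s≤s lt) , ℕ.≤⇒≤ᵇ (s≤s le))

-- The free bound `N` lets π on m letters be measured with the bound `suc m` of its enlargement; the
-- free predicate `E` lets an excedance be recognised by its letter instead of its place.
den-inversions : ∀ r₀ (π : Permutation′ n) N → n ≤ N →
  {E : Fin n → Set} (E? : ∀ j → Dec (E j)) →
  (∀ j → E j → Excedance r₀ π j) → (∀ j → Excedance r₀ π j → E j) →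
  den (suc r₀) π ≡ triangle (count E?) + inversions (λ j → key N (E? j) (toℕ (π ⟨$⟩ʳ j)))
den-inversions {n} r₀ π N n≤N {E} E? E⇒ ⇒E = begin
  den (suc r₀) π
    ≡⟨ den-tabulate N (isExcp (suc r₀) π) (val π) val< pos 0 (λ j → j) (λ _ → refl) ⟩
  triangle (count (λ j → T? (isExcp (suc r₀) π j))) + inversions K
    ≡⟨ cong₂ (λ a b → triangle a + b) (count-cong _ E? (λ j → ⇒E j ∘ T-isExcp r₀ π j) (λ j → isExcp-T r₀ π j ∘ E⇒ j))
         (inversions-cong (λ i j lt → s<s⁻¹ (subst₂ _<_ (K≡ j) (K≡ i) lt)) (λ i j lt → subst₂ _<_ (sym (K≡ j)) (sym (K≡ i)) (s≤s lt))) ⟩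
  triangle (count E?) + inversions (λ j → key N (E? j) (toℕ (π ⟨$⟩ʳ j))) ∎
  where
  open ≡-Reasoning
  K : Fin n → ℕ
  K j = key N (T? (isExcp (suc r₀) π j)) (val π j)
  val< : ∀ i j → val π i < N + val π j
  val< i j = ℕ.≤-trans (s≤s (ℕ.≤-trans (Fin.toℕ<n _) n≤N))
    (ℕ.≤-trans (s≤s (ℕ.m≤m+n N _)) (ℕ.≤-reflexive (sym (ℕ.+-suc N _))))
  -- `val` counts letters from 1 and the key in the conclusion from 0; adding `N` commutes with the
  -- successor, so the order is the same.
  K≡ : ∀ j → K j ≡ suc (key N (E? j) (toℕ (π ⟨$⟩ʳ j)))
  K≡ j with E? j
  ... | yes Ej = key-yes N (T? (isExcp (suc r₀) π j)) _ (isExcp-T r₀ π j (E⇒ j Ej))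
  ... | no ¬Ej = trans (key-no N (T? (isExcp (suc r₀) π j)) _ (¬Ej ∘ ⇒E j ∘ T-isExcp r₀ π j)) (ℕ.+-suc N _)

exc-count : ∀ r₀ (π : Permutation′ n) →
            exc (suc r₀) π ≡ count (λ j → j Fin.<? (π ⟨$⟩ʳ j) ×-dec r₀ ℕ.≤? toℕ j)
exc-count r₀ π = trans (length-filter _ (λ j → j)) (count-cong _ _ to from)
  where
  to : ∀ j → T ((pos j <ᵇ val π j) ∧ (suc r₀ ≤ᵇ pos j)) → toℕ j < toℕ (π ⟨$⟩ʳ j) × r₀ ≤ toℕ j
  to j t with lt , le ← Equivalence.to (T-∧ {pos j <ᵇ val π j}) t =
    s<s⁻¹ (ℕ.<ᵇ⇒< _ _ lt) , s≤s⁻¹ (ℕ.≤ᵇ⇒≤ _ _ le)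
  from : ∀ j → toℕ j < toℕ (π ⟨$⟩ʳ j) × r₀ ≤ toℕ j → T ((pos j <ᵇ val π j) ∧ (suc r₀ ≤ᵇ pos j))
  from j (lt , le) =
    Equivalence.from (T-∧ {pos j <ᵇ val π j}) (ℕ.<⇒<ᵇ (s≤s lt) , ℕ.≤⇒≤ᵇ (s≤s le))

-- Counting unions, intervals and crossings; order facts on `punchIn` and `key`

count-∪ : {P Q R : Fin n → Set} (P? : ∀ i → Dec (P i)) (Q? : ∀ i → Dec (Q i)) (R? : ∀ i → Dec (R i)) →
          (∀ i → R i → P i ⊎ Q i) → count R? ≤ count P? + count Q?
count-∪ {P = P} {Q} {R} P? Q? R? R⇒ = begin
  count R?                                            ≤⟨ count-mono R? (λ i → P? i ⊎-dec Q? i) R⇒ ⟩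
  count (λ i → P? i ⊎-dec Q? i)                       ≡⟨ count-⊎ P? (λ i → Q? i ×-dec ¬? (P? i)) (λ i → P? i ⊎-dec Q? i)
                                                           split (λ _ → inj₁) (λ _ → inj₂ ∘ proj₁) (λ _ p (_ , ¬p) → ¬p p) ⟩
  count P? + count (λ i → Q? i ×-dec ¬? (P? i))       ≤⟨ ℕ.+-monoʳ-≤ (count P?) (count-mono (λ i → Q? i ×-dec ¬? (P? i)) Q? (λ _ → proj₁)) ⟩
  count P? + count Q?                                 ∎
  where
  open ℕ.≤-Reasoning
  split : ∀ i → P i ⊎ Q i → P i ⊎ (Q i × ¬ P i)
  split i pq with P? i | pq
  ... | yes p | _      = inj₁ p
  ... | no ¬p | inj₁ p = contradiction p ¬p
  ... | no ¬p | inj₂ q = inj₂ (q , ¬p)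

count-interval : ∀ {n} a (x : Fin n) → a ≤ toℕ x →
                 count (λ i → a ℕ.≤? toℕ i ×-dec i Fin.<? x) + a ≡ toℕ x
count-interval {n} a x a≤x = begin
  count (λ i → a ℕ.≤? toℕ i ×-dec i Fin.<? x) + a
    ≡⟨ cong (count (λ i → a ℕ.≤? toℕ i ×-dec i Fin.<? x) +_) (count-toℕ< {n} a (ℕ.≤-trans a≤x (ℕ.<⇒≤ (Fin.toℕ<n x)))) ⟨
  count (λ i → a ℕ.≤? toℕ i ×-dec i Fin.<? x) + count {n} (λ i → toℕ i ℕ.<? a)
    ≡⟨ count-⊎ (λ i → a ℕ.≤? toℕ i ×-dec i Fin.<? x) (λ i → toℕ i ℕ.<? a) (λ i → i Fin.<? x)
         split (λ _ → proj₂) (λ i i<a → ℕ.<-≤-trans i<a a≤x) (λ i (a≤i , _) → ℕ.≤⇒≯ a≤i) ⟨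
  count (λ i → i Fin.<? x)
    ≡⟨ count-< x ⟩
  toℕ x ∎
  where
  open ≡-Reasoning
  split : ∀ i → toℕ i < toℕ x → (a ≤ toℕ i × toℕ i < toℕ x) ⊎ toℕ i < a
  split i i<x with toℕ i ℕ.<? a
  ... | yes i<a = inj₂ i<a
  ... | no  i≮a = inj₁ (ℕ.≮⇒≥ i≮a , i<x)

count-≥ : ∀ {n} a → a ≤ n → count {n} (λ i → a ℕ.≤? toℕ i) + a ≡ n
count-≥ {n} a a≤n = begin
  count {n} (λ i → a ℕ.≤? toℕ i) + a
    ≡⟨ cong (count {n} (λ i → a ℕ.≤? toℕ i) +_) (count-toℕ< {n} a a≤n) ⟨
  count {n} (λ i → a ℕ.≤? toℕ i) + count {n} (λ i → toℕ i ℕ.<? a)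
    ≡⟨ count-⊎ (λ i → a ℕ.≤? toℕ i) (λ i → toℕ i ℕ.<? a) (λ i → toℕ i ℕ.<? n)
         split (λ i _ → Fin.toℕ<n i) (λ i _ → Fin.toℕ<n i) (λ i → ℕ.≤⇒≯) ⟨
  count {n} (λ i → toℕ i ℕ.<? n)
    ≡⟨ count-toℕ< n ℕ.≤-refl ⟩
  n ∎
  where
  open ≡-Reasoning
  split : ∀ i → toℕ i < n → (a ≤ toℕ i) ⊎ toℕ i < a
  split i _ with toℕ i ℕ.<? a
  ... | yes i<a = inj₂ i<a
  ... | no  i≮a = inj₁ (ℕ.≮⇒≥ i≮a)

-- As many letters as places lie below x. Discarding the places before x whose letters are also
-- below x leaves the two kinds of crossing, equal in number because x itself is fixed.
count-crossings : (σ : Permutation′ n) (x : Fin n) → σ ⟨$⟩ʳ x ≡ x →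
  count (λ i → x Fin.<? i ×-dec (σ ⟨$⟩ʳ i) Fin.<? x) ≡ count (λ i → i Fin.<? x ×-dec x Fin.<? (σ ⟨$⟩ʳ i))
count-crossings σ x σx≡x = ℕ.+-cancelˡ-≡ (count stay?) _ _ (begin
  count stay? + count (λ i → x Fin.<? i ×-dec (σ ⟨$⟩ʳ i) Fin.<? x)
    ≡⟨ count-⊎ stay? (λ i → x Fin.<? i ×-dec (σ ⟨$⟩ʳ i) Fin.<? x) (λ i → (σ ⟨$⟩ʳ i) Fin.<? x)
         enter (λ _ → proj₂) (λ _ → proj₂) (λ _ (i<x , _) (x<i , _) → ℕ.<-asym i<x x<i) ⟨
  count (λ i → (σ ⟨$⟩ʳ i) Fin.<? x)
    ≡⟨ count-permute (Fin._<? x) σ ⟨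
  count (λ i → i Fin.<? x)
    ≡⟨ count-⊎ stay? (λ i → i Fin.<? x ×-dec x Fin.<? (σ ⟨$⟩ʳ i)) (λ i → i Fin.<? x)
         leave (λ _ → proj₁) (λ _ → proj₁) (λ _ (_ , lt) (_ , gt) → ℕ.<-asym lt gt) ⟩
  count stay? + count (λ i → i Fin.<? x ×-dec x Fin.<? (σ ⟨$⟩ʳ i)) ∎)
  where
  open ≡-Reasoning
  stay? = λ i → i Fin.<? x ×-dec (σ ⟨$⟩ʳ i) Fin.<? x
  enter : ∀ i → toℕ (σ ⟨$⟩ʳ i) < toℕ x →
          (toℕ i < toℕ x × toℕ (σ ⟨$⟩ʳ i) < toℕ x) ⊎ (toℕ x < toℕ i × toℕ (σ ⟨$⟩ʳ i) < toℕ x)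
  enter i lt with Fin.<-cmp i x
  ... | tri< i<x _ _  = inj₁ (i<x , lt)
  ... | tri≈ _ refl _ = contradiction (cong toℕ σx≡x) (ℕ.<⇒≢ lt)
  ... | tri> _ _ x<i  = inj₂ (x<i , lt)
  leave : ∀ i → toℕ i < toℕ x →
          (toℕ i < toℕ x × toℕ (σ ⟨$⟩ʳ i) < toℕ x) ⊎ (toℕ i < toℕ x × toℕ x < toℕ (σ ⟨$⟩ʳ i))
  leave i i<x with Fin.<-cmp (σ ⟨$⟩ʳ i) x
  ... | tri< lt _ _ = inj₁ (i<x , lt)
  ... | tri≈ _ eq _ = contradiction (cong toℕ (⟨$⟩ʳ-injective σ (trans eq (sym σx≡x)))) (ℕ.<⇒≢ i<x)
  ... | tri> _ _ gt = inj₂ (i<x , gt)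

toℕ-punchIn : ∀ (x : Fin (suc n)) j → (toℕ j < toℕ x × toℕ (punchIn x j) ≡ toℕ j)
                                    ⊎ (toℕ x ≤ toℕ j × toℕ (punchIn x j) ≡ suc (toℕ j))
toℕ-punchIn zero    j    = inj₂ (z≤n , refl)
toℕ-punchIn (suc x) zero = inj₁ (s≤s z≤n , refl)
toℕ-punchIn (suc x) (suc j) with toℕ-punchIn x j
... | inj₁ (j<x , eq) = inj₁ (s≤s j<x , cong suc eq)
... | inj₂ (x≤j , eq) = inj₂ (s≤s x≤j , cong suc eq)

data PunchView (x : Fin (suc n)) : Fin (suc n) → Set where
  self    : PunchView x x
  punched : ∀ j → PunchView x (punchIn x j)

punchView : (x i : Fin (suc n)) → PunchView x i
punchView x i with x Fin.≟ i
... | yes refl = self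
... | no x≢i   = subst (PunchView x) (Fin.punchIn-punchOut x≢i) (punched (punchOut x≢i))

key-injective : ∀ {N} {E : Fin n → Set} (E? : ∀ i → Dec (E i)) {v : Fin n → ℕ} → (∀ i → v i < N) →
                Injective _≡_ _≡_ v → Injective _≡_ _≡_ (λ i → key N (E? i) (v i))
key-injective {N = N} E? v<N v-injective {i} {j} eq with E? i | E? j
... | yes _ | yes _ = v-injective eq
... | yes _ | no _  = contradiction eq (ℕ.<⇒≢ (ℕ.<-≤-trans (v<N i) (ℕ.m≤m+n N _)))
... | no _  | yes _ = contradiction (sym eq) (ℕ.<⇒≢ (ℕ.<-≤-trans (v<N j) (ℕ.m≤m+n N _)))
... | no _  | no _  = v-injective (ℕ.+-cancelˡ-≡ N _ _ eq)

mono⇒cancel : {v w : Fin n → ℕ} → Injective _≡_ _≡_ v → (∀ i j → v i < v j → w i < w j) →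
              ∀ i j → w i < w j → v i < v j
mono⇒cancel {v = v} v-injective mono i j lt with ℕ.<-cmp (v i) (v j)
... | tri< vi<vj _ _ = vi<vj
... | tri≈ _ eq _ rewrite v-injective eq = contradiction lt (ℕ.<-irrefl refl)
... | tri> _ _ vj<vi = contradiction lt (ℕ.<-asym (mono j i vj<vi))

toℕ-punchIn-top : ∀ {m} (v : Fin m) → toℕ (punchIn (fromℕ m) v) ≡ toℕ v
toℕ-punchIn-top zero    = refl
toℕ-punchIn-top (suc v) = cong suc (toℕ-punchIn-top v)

-- Insertion at a place x ≥ r₀

module Enlarged (r₀ m : ℕ) (r₀≤m : r₀ ≤ m) (π : Permutation′ m) where

  top : Fin (suc m)
  top = fromℕ m

  lift : Fin m → Fin (suc m)
  lift = punchIn top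

  excedance? : ∀ j → Dec (Excedance r₀ π j)
  excedance? j = j Fin.<? (π ⟨$⟩ʳ j) ×-dec r₀ ℕ.≤? toℕ (π ⟨$⟩ʳ j)

  -- The r-level excedance letters of π together with the new letter n.
  E : Fin (suc m) → Set
  E v = v ≡ top ⊎ ∃ λ j → v ≡ lift (π ⟨$⟩ʳ j) × Excedance r₀ π j

  opaque
    E? : ∀ v → Dec (E v)
    E? v = v Fin.≟ top ⊎-dec Fin.any? (λ j → v Fin.≟ lift (π ⟨$⟩ʳ j) ×-dec excedance? j)

  E⇒≥r₀ : ∀ v → E v → r₀ ≤ toℕ v
  E⇒≥r₀ v (inj₁ refl) = ℕ.≤-trans r₀≤m (ℕ.≤-reflexive (sym (Fin.toℕ-fromℕ m)))
  E⇒≥r₀ v (inj₂ (j , refl , _ , r₀≤)) = ℕ.≤-trans r₀≤ (ℕ.≤-reflexive (sym (toℕ-punchIn-top _)))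

  lift-E : ∀ j → E (lift (π ⟨$⟩ʳ j)) → Excedance r₀ π j
  lift-E j (inj₁ eq) = contradiction eq (Fin.punchInᵢ≢i top _)
  lift-E j (inj₂ (j′ , eq , exc)) =
    subst (Excedance r₀ π) (sym (⟨$⟩ʳ-injective π (Fin.punchIn-injective top _ _ eq))) exc

  opaque
    -- Ranks the letters of E below all the others.
    K : Fin (suc m) → ℕ
    K v = key (suc m) (E? v) (toℕ v)

    K-injective : Injective _≡_ _≡_ K
    K-injective = key-injective E? Fin.toℕ<n Fin.toℕ-injective

    K-E : ∀ v → E v → K v ≡ toℕ v
    K-E v = key-yes (suc m) (E? v) (toℕ v)

    K-¬E : ∀ v → ¬ E v → K v ≡ suc m + toℕ v
    K-¬E v = key-no (suc m) (E? v) (toℕ v)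

    den-K : (σ : Permutation′ (suc m)) → (∀ i → E (σ ⟨$⟩ʳ i) → Excedance r₀ σ i) →
            (∀ i → Excedance r₀ σ i → E (σ ⟨$⟩ʳ i)) →
            den (suc r₀) σ ≡ triangle (count E?) + inversions (λ i → K (σ ⟨$⟩ʳ i))
    den-K σ E⇒ ⇒E = trans
      (den-inversions r₀ σ (suc m) ℕ.≤-refl (λ i → E? (σ ⟨$⟩ʳ i)) E⇒ ⇒E)
      (cong (λ k → triangle k + inversions (λ i → K (σ ⟨$⟩ʳ i))) (sym (count-permute E? σ)))

  E<¬E : ∀ v w → E v → ¬ E w → K v < K w
  E<¬E v w v∈E w∉E rewrite K-E v v∈E | K-¬E w w∉E = ℕ.<-≤-trans (Fin.toℕ<n v) (ℕ.m≤m+n (suc m) _)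

  E<E : ∀ v w → E v → E w → v <ᶠ w → K v < K w
  E<E v w v∈E w∈E v<w rewrite K-E v v∈E | K-E w w∈E = v<w

  E<E⁻¹ : ∀ v w → E v → E w → K v < K w → v <ᶠ w
  E<E⁻¹ v w v∈E w∈E lt rewrite K-E v v∈E | K-E w w∈E = lt

  E-down : ∀ v w → E w → K v < K w → E v
  E-down v w w∈E lt with toSum (E? v)
  ... | inj₁ v∈E = v∈E
  ... | inj₂ v∉E = contradiction (E<¬E w v w∈E v∉E) (ℕ.<-asym lt)

  module At (x : Fin (suc m)) (r₀≤x : r₀ ≤ toℕ x) where

    S : Fin (suc m) → Set
    S v = E v × x ≤ᶠ v

    ≤top : ∀ (v : Fin (suc m)) → v ≤ᶠ top
    ≤top v = ℕ.≤-trans (s≤s⁻¹ (Fin.toℕ<n v)) (ℕ.≤-reflexive (sym (Fin.toℕ-fromℕ m)))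

    open Rotation (λ v → E? v ×-dec x Fin.≤? v) Fin.toℕ-injective
                  {top} (inj₁ refl , ≤top x) (λ u _ → ≤top u) public

    opaque
      -- Insert the letter n at place x, then push the letters of E that are ≥ x one step up in E.
      -- An excedance letter of a place that moves right grows too, so it stays an excedance letter.
      σ : Permutation′ (suc m)
      σ = insert x top π Perm.∘ₚ rotation

      σ-Rotates : ∀ i → Rotates S toℕ top (insert x top π ⟨$⟩ʳ i) (σ ⟨$⟩ʳ i)
      σ-Rotates i = rotation-Rotates (insert x top π ⟨$⟩ʳ i)

    p : Fin m → Fin (suc m)
    p = punchIn x

    y : Fin (suc m)
    y = σ ⟨$⟩ʳ x

    private
      y-Rotates : Rotates S toℕ top top y
      y-Rotates = subst (λ v → Rotates S toℕ top v y) (insert-self x top π)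
                        (σ-Rotates x)

    y-spec : E y × x ≤ᶠ y × (∀ v → E v → x ≤ᶠ v → y ≤ᶠ v)
    y-spec with y-Rotates
    ... | wraps _ (y∈E , x≤y) min = y∈E , x≤y , λ v v∈E x≤v → min v (v∈E , x≤v)
    ... | steps t≢t _ _ _ _ = contradiction refl t≢t
    ... | fixes t∉S _ = contradiction (inj₁ refl , ≤top x) t∉S

    y∈E = proj₁ y-spec
    x≤y = proj₁ (proj₂ y-spec)
    y-min = proj₂ (proj₂ y-spec)

    data Image (j : Fin m) (w : Fin (suc m)) : Set where
      raised : Excedance r₀ π j → x ≤ᶠ lift (π ⟨$⟩ʳ j) → E w → lift (π ⟨$⟩ʳ j) <ᶠ w →
               (∀ v → E v → lift (π ⟨$⟩ʳ j) <ᶠ v → w ≤ᶠ v) → Image j w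
      kept   : (Excedance r₀ π j → lift (π ⟨$⟩ʳ j) <ᶠ x) → w ≡ lift (π ⟨$⟩ʳ j) → Image j w

    image : ∀ j → Image j (σ ⟨$⟩ʳ p j)
    image j with subst (λ v → Rotates S toℕ top v (σ ⟨$⟩ʳ p j)) (Perm.insert-punchIn x top π j)
                       (σ-Rotates (p j))
    ... | wraps eq _ _ = contradiction eq (Fin.punchInᵢ≢i top _)
    ... | steps _ (v∈E , x≤v) (w∈E , x≤w) v<w next =
      raised (lift-E j v∈E) x≤v w∈E v<w λ v v∈E v<v′ → next v (v∈E , ℕ.≤-trans x≤v (ℕ.<⇒≤ v<v′)) v<v′
    ... | fixes v∉S eq = kept (λ exc → ℕ.≰⇒> λ x≤v → v∉S (inj₂ (j , refl , exc) , x≤v)) eq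

    Excedance⇒E : ∀ j → Excedance r₀ π j → E (σ ⟨$⟩ʳ p j)
    Excedance⇒E j exc with image j
    ... | raised _ _ w∈E _ _ = w∈E
    ... | kept _ eq          = inj₂ (j , eq , exc)

    E⇒Excedance : ∀ j → E (σ ⟨$⟩ʳ p j) → Excedance r₀ π j
    E⇒Excedance j w∈E with image j
    ... | raised exc _ _ _ _ = exc
    ... | kept _ eq          = lift-E j (subst E eq w∈E)

    Excedance-p : ∀ j → Excedance r₀ π j → Excedance r₀ σ (p j)
    Excedance-p j exc@(j<πj , r₀≤πj) with image j
    ... | raised _ _ _ v<w _ rewrite toℕ-punchIn-top (π ⟨$⟩ʳ j) =
      ℕ.≤-<-trans p≤v v<w , ℕ.≤-trans r₀≤πj (ℕ.<⇒≤ v<w)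
      where
      p≤v : toℕ (p j) ≤ toℕ (π ⟨$⟩ʳ j)
      p≤v with toℕ-punchIn x j
      ... | inj₁ (_ , eq) rewrite eq = ℕ.<⇒≤ j<πj
      ... | inj₂ (_ , eq) rewrite eq = j<πj
    ... | kept <x eq rewrite eq | toℕ-punchIn-top (π ⟨$⟩ʳ j) = p<v , r₀≤πj
      where
      p<v : toℕ (p j) < toℕ (π ⟨$⟩ʳ j)
      p<v with toℕ-punchIn x j
      ... | inj₁ (_ , eq) rewrite eq = j<πj
      -- A place that shifts has `x ≤ j < π j`, so its excedance letter cannot have been kept.
      ... | inj₂ (x≤j , _) = contradiction (<x exc) (ℕ.≤⇒≯ (ℕ.≤-trans x≤j (ℕ.<⇒≤ j<πj)))

    Excedance-p⁻¹ : ∀ j → Excedance r₀ σ (p j) → Excedance r₀ π j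
    Excedance-p⁻¹ j (p<w , r₀≤w) with image j
    ... | raised exc _ _ _ _ = exc
    ... | kept _ eq rewrite eq | toℕ-punchIn-top (π ⟨$⟩ʳ j) = ℕ.≤-<-trans j≤p p<w , r₀≤w
      where
      j≤p : toℕ j ≤ toℕ (p j)
      j≤p with toℕ-punchIn x j
      ... | inj₁ (_ , eq) = ℕ.≤-reflexive (sym eq)
      ... | inj₂ (_ , eq) = ℕ.≤-trans (ℕ.n≤1+n _) (ℕ.≤-reflexive (sym eq))

    E⇒Excedance-σ : ∀ i → i ≢ x → E (σ ⟨$⟩ʳ i) → Excedance r₀ σ i
    E⇒Excedance-σ i i≢x with punchView x i
    ... | self      = λ _ → contradiction refl i≢x
    ... | punched j = Excedance-p j ∘ E⇒Excedance j

    Excedance-σ⇒E : ∀ i → i ≢ x → Excedance r₀ σ i → E (σ ⟨$⟩ʳ i)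
    Excedance-σ⇒E i i≢x with punchView x i
    ... | self      = λ _ → contradiction refl i≢x
    ... | punched j = Excedance⇒E j ∘ Excedance-p⁻¹ j

    -- The witness is the letter that this place held in π. The place moved from i - 1 to i, so an
    -- excedance letter there was at least i; being also ≥ x, it was raised.
    E-between : ∀ i → x <ᶠ i → E (σ ⟨$⟩ʳ i) → ∃ λ v → E v × i ≤ᶠ v × v <ᶠ (σ ⟨$⟩ʳ i)
    E-between i x<i w∈E with punchView x i
    ... | self = contradiction x<i (ℕ.<-irrefl refl)
    ... | punched j with toℕ-punchIn x j
    ...   | inj₁ (j<x , eq) = contradiction x<i (ℕ.<-asym (subst (_< toℕ x) (sym eq) j<x))
    ...   | inj₂ (x≤j , eq) with image j
    ...     | raised exc@(j<v , _) _ _ v<w _ =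
      lift (π ⟨$⟩ʳ j) , inj₂ (j , refl , exc) ,
      subst₂ _≤_ (sym eq) (sym (toℕ-punchIn-top _)) j<v , v<w
    ...     | kept <x eq′ with exc@(j<v , _) ← lift-E j (subst E eq′ w∈E) =
      contradiction (<x exc) (ℕ.≤⇒≯ (ℕ.≤-trans x≤j (ℕ.≤-trans (ℕ.<⇒≤ j<v)
        (ℕ.≤-reflexive (sym (toℕ-punchIn-top _))))))

    -- Each letter of E right of x has jumped over a letter of E that is ≥ x, and `y` is the least
    -- of those.
    E-above : ∀ i → x <ᶠ i → E (σ ⟨$⟩ʳ i) → y <ᶠ (σ ⟨$⟩ʳ i)
    E-above i x<i w∈E with E-between i x<i w∈E
    ... | v , v∈E , i≤v , v<w = ℕ.≤-<-trans (y-min v v∈E (ℕ.≤-trans (ℕ.<⇒≤ x<i) i≤v)) v<w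

    -- From r₀ on, a letter that is not an excedance letter is at most its place j; it stays, while
    -- the place becomes j + 1.
    ¬E-below : ∀ i → x <ᶠ i → ¬ E (σ ⟨$⟩ʳ i) → (σ ⟨$⟩ʳ i) <ᶠ i
    ¬E-below i x<i w∉E with punchView x i
    ... | self = contradiction x<i (ℕ.<-irrefl refl)
    ... | punched j with toℕ-punchIn x j
    ...   | inj₁ (j<x , eq) = contradiction x<i (ℕ.<-asym (subst (_< toℕ x) (sym eq) j<x))
    ...   | inj₂ (x≤j , eq) with image j
    ...     | raised _ _ w∈E _ _ = contradiction w∈E w∉E
    ...     | kept _ eq′ rewrite eq′ | eq | toℕ-punchIn-top (π ⟨$⟩ʳ j) =
      s≤s (ℕ.≮⇒≥ λ j<v → w∉E (inj₂ (j , refl , j<v ,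
        ℕ.≤-trans r₀≤x (ℕ.≤-trans x≤j (ℕ.<⇒≤ j<v)))))

    Kπ : Fin m → ℕ
    Kπ j = key (suc m) (excedance? j) (toℕ (π ⟨$⟩ʳ j))

    raise-mono : ∀ i j → Excedance r₀ π i → Excedance r₀ π j → (π ⟨$⟩ʳ i) <ᶠ (π ⟨$⟩ʳ j) →
                 (σ ⟨$⟩ʳ p i) <ᶠ (σ ⟨$⟩ʳ p j)
    raise-mono i j exc-i exc-j lt
      with lt′ ← subst₂ _<_ (sym (toℕ-punchIn-top (π ⟨$⟩ʳ i))) (sym (toℕ-punchIn-top (π ⟨$⟩ʳ j))) lt
      with image i | image j
    ... | raised _ _ _ _ next | raised _ _ _ v<w _ = ℕ.≤-<-trans (next _ (inj₂ (j , refl , exc-j)) lt′) v<w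
    ... | raised _ x≤ _ _ _ | kept <x _ = contradiction (ℕ.<-trans lt′ (<x exc-j)) (ℕ.≤⇒≯ x≤)
    ... | kept _ eq | raised _ _ _ v<w _ rewrite eq = ℕ.<-trans lt′ v<w
    ... | kept _ eq | kept _ eq′ rewrite eq | eq′ = lt′

    unmoved : ∀ j → ¬ Excedance r₀ π j → toℕ (σ ⟨$⟩ʳ p j) ≡ toℕ (π ⟨$⟩ʳ j)
    unmoved j ¬exc with image j
    ... | raised exc _ _ _ _ = contradiction exc ¬exc
    ... | kept _ eq = trans (cong toℕ eq) (toℕ-punchIn-top _)

    -- Raising preserves the order of the old excedance letters, the other letters stay, and the two
    -- classes remain apart. Hence every inversion gained involves the new place.
    Kσ-mono : ∀ i j → Kπ i < Kπ j → K (σ ⟨$⟩ʳ p i) < K (σ ⟨$⟩ʳ p j)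
    Kσ-mono i j lt with excedance? i | excedance? j
    ... | yes exc-i | yes exc-j = E<E _ _ (Excedance⇒E i exc-i) (Excedance⇒E j exc-j) (raise-mono i j exc-i exc-j lt)
    ... | yes exc-i | no ¬exc-j = E<¬E _ _ (Excedance⇒E i exc-i) (¬exc-j ∘ E⇒Excedance j)
    ... | no _ | yes _ = contradiction lt (ℕ.≤⇒≯ (ℕ.≤-trans (ℕ.<⇒≤ (Fin.toℕ<n (π ⟨$⟩ʳ j))) (ℕ.≤-trans (ℕ.n≤1+n m) (ℕ.m≤m+n (suc m) _))))
    ... | no ¬exc-i | no ¬exc-j
      rewrite K-¬E _ (¬exc-i ∘ E⇒Excedance i) | K-¬E _ (¬exc-j ∘ E⇒Excedance j)
            | unmoved i ¬exc-i | unmoved j ¬exc-j = lt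

    Kσ-cancel : ∀ i j → K (σ ⟨$⟩ʳ p i) < K (σ ⟨$⟩ʳ p j) → Kπ i < Kπ j
    Kσ-cancel = mono⇒cancel (key-injective excedance? (λ j → ℕ.m<n⇒m<1+n (Fin.toℕ<n (π ⟨$⟩ʳ j)))
      (⟨$⟩ʳ-injective π ∘ Fin.toℕ-injective)) Kσ-mono

-- Effect of an insertion at x ≥ r₀ on the two statistics

module InsertionStatistics (r₀ m : ℕ) (r₀≤m : r₀ ≤ m) (π : Permutation′ m) (x : Fin (suc m)) (r₀≤x : r₀ ≤ toℕ x) where
  open Enlarged r₀ m r₀≤m π
  open At x r₀≤x

  σ_ : Fin (suc m) → Fin (suc m)
  σ_ i = σ ⟨$⟩ʳ i

  E-above? : ∀ v → Dec (E v × x <ᶠ v)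
  E-above? v = E? v ×-dec x Fin.<? v

  E-under? : ∀ v → Dec (E v × v <ᶠ x)
  E-under? v = E? v ×-dec v Fin.<? x

  x≢p : ∀ j → p j ≢ x
  x≢p j = Fin.punchInᵢ≢i x j

  count-E : count E? ≡ suc (count excedance?)
  count-E = begin
    count E?                         ≡⟨ count-permute E? σ ⟩
    count (λ i → E? (σ_ i))          ≡⟨ count-remove-yes (λ i → E? (σ_ i)) x y∈E ⟩
    suc (count (λ j → E? (σ_ (p j)))) ≡⟨ cong suc (count-cong (λ j → E? (σ_ (p j))) excedance? E⇒Excedance Excedance⇒E) ⟩
    suc (count excedance?)           ∎
    where
    open ≡-Reasoning

  old-inversions : inversions (λ j → K (σ_ (p j))) ≡ inversions Kπ
  old-inversions = inversions-cong (λ i j → Kσ-cancel j i) (λ i j → Kσ-mono j i)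

  den-π : den (suc r₀) π ≡ triangle (count excedance?) + inversions Kπ
  den-π = den-inversions r₀ π (suc m) (ℕ.n≤1+n m) excedance? (λ _ e → e) (λ _ e → e)

  -- A letter declared smaller than `y` is a smaller letter of E, and right of x all letters of E
  -- exceed `y`.
  no-inversion-after : count (λ j → inversion? (K ∘ σ_) j x) ≡ 0
  no-inversion-after = count-none (λ j → inversion? (K ∘ σ_) j x) none
    where
    none : ∀ j → ¬ Inversion (K ∘ σ_) j x
    none j (x<j , lt) = ℕ.<-asym (E-above j x<j w∈E) (E<E⁻¹ _ _ w∈E y∈E lt)
      where w∈E = E-down (σ_ j) y y∈E lt

  -- A place before x holds either a letter declared larger than `y` or a letter of E below x. By
  -- `E-above` all letters of E below x do stand before x, so the two counts exhaust these places.
  inversions-before : column (K ∘ σ_) x + count E-under? ≡ toℕ x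
  inversions-before = begin
    column (K ∘ σ_) x + count E-under?
      ≡⟨ cong (column (K ∘ σ_) x +_) (count-permute E-under? σ) ⟩
    column (K ∘ σ_) x + count (λ i → E-under? (σ_ i))
      ≡⟨ count-⊎ (inversion? (K ∘ σ_) x) (λ i → E-under? (σ_ i)) (λ i → i Fin.<? x) split (λ _ → proj₁) before disjoint ⟨
    count (λ i → i Fin.<? x)
      ≡⟨ count-< x ⟩
    toℕ x ∎
    where
    open ≡-Reasoning
    split : ∀ i → i <ᶠ x → Inversion (K ∘ σ_) x i ⊎ (E (σ_ i) × σ_ i <ᶠ x)
    split i i<x with toSum (E? (σ_ i)) | toSum (σ_ i Fin.<? x)
    ... | inj₂ w∉E | _        = inj₁ (i<x , E<¬E y (σ_ i) y∈E w∉E)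
    ... | inj₁ w∈E | inj₁ w<x = inj₂ (w∈E , w<x)
    ... | inj₁ w∈E | inj₂ w≮x = inj₁ (i<x , E<E y (σ_ i) y∈E w∈E
      (ℕ.≤∧≢⇒< (y-min (σ_ i) w∈E (ℕ.≮⇒≥ w≮x))
        λ eq → Fin.<⇒≢ i<x (⟨$⟩ʳ-injective σ (Fin.toℕ-injective (sym eq)))))
    before : ∀ i → E (σ_ i) × σ_ i <ᶠ x → i <ᶠ x
    before i (w∈E , w<x) with Fin.<-cmp i x
    ... | tri< i<x _ _  = i<x
    ... | tri≈ _ refl _ = contradiction w<x (ℕ.≤⇒≯ x≤y)
    ... | tri> _ _ x<i  = contradiction (ℕ.<-trans (E-above i x<i w∈E) w<x) (ℕ.≤⇒≯ x≤y)
    disjoint : ∀ i → Inversion (K ∘ σ_) x i → ¬ (E (σ_ i) × σ_ i <ᶠ x)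
    disjoint i (_ , lt) (w∈E , w<x) = ℕ.<⇒≱ (ℕ.<-trans (E<E⁻¹ _ _ y∈E w∈E lt) w<x) x≤y

  count-E-split : ¬ E x → count E? ≡ count E-under? + count E-above?
  count-E-split x∉E = count-⊎ E-under? E-above? E? split (λ _ → proj₁) (λ _ → proj₁)
    (λ _ (_ , v<x) (_ , x<v) → ℕ.<-asym v<x x<v)
    where
    split : ∀ v → E v → (E v × v <ᶠ x) ⊎ (E v × x <ᶠ v)
    split v v∈E with Fin.<-cmp v x
    ... | tri< v<x _ _  = inj₁ (v∈E , v<x)
    ... | tri≈ _ refl _ = contradiction v∈E x∉E
    ... | tri> _ _ x<v  = inj₂ (v∈E , x<v)

  inversions-σ : inversions (K ∘ σ_) ≡ inversions Kπ + column (K ∘ σ_) x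
  inversions-σ = begin
    inversions (K ∘ σ_)
      ≡⟨ inversions-remove (K ∘ σ_) x ⟩
    inversions (K ∘ σ_ ∘ p) + (column (K ∘ σ_) x + count (λ j → inversion? (K ∘ σ_) j x))
      ≡⟨ cong₂ (λ a b → a + (column (K ∘ σ_) x + b)) old-inversions no-inversion-after ⟩
    inversions Kπ + (column (K ∘ σ_) x + 0)
      ≡⟨ cong (inversions Kπ +_) (ℕ.+-identityʳ _) ⟩
    inversions Kπ + column (K ∘ σ_) x ∎
    where
    open ≡-Reasoning

  Old : Fin m → Set
  Old j = p j <ᶠ σ_ (p j) × r₀ ≤ toℕ (p j)

  old? : ∀ j → Dec (Old j)
  old? j = p j Fin.<? σ_ (p j) ×-dec r₀ ℕ.≤? toℕ (p j)

  exc-old : count old? ≡ exc (suc r₀) π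
  exc-old = trans (count-cong old? (λ j → j Fin.<? (π ⟨$⟩ʳ j) ×-dec r₀ ℕ.≤? toℕ j) to from) (sym (exc-count r₀ π))
    where
    to : ∀ j → Old j → j <ᶠ (π ⟨$⟩ʳ j) × r₀ ≤ toℕ j
    to j (p<w , r₀≤p) = proj₁ (Excedance-p⁻¹ j (p<w , ℕ.≤-trans r₀≤p (ℕ.<⇒≤ p<w))) , r₀≤j
      where
      r₀≤j : r₀ ≤ toℕ j
      r₀≤j with toℕ-punchIn x j
      ... | inj₁ (_ , eq)  = subst (r₀ ≤_) eq r₀≤p
      ... | inj₂ (x≤j , _) = ℕ.≤-trans r₀≤x x≤j
    from : ∀ j → j <ᶠ (π ⟨$⟩ʳ j) × r₀ ≤ toℕ j → Old j
    from j (j<v , r₀≤j) = proj₁ (Excedance-p j (j<v , ℕ.≤-trans r₀≤j (ℕ.<⇒≤ j<v))) , r₀≤p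
      where
      r₀≤p : r₀ ≤ toℕ (p j)
      r₀≤p with toℕ-punchIn x j
      ... | inj₁ (_ , eq) = subst (r₀ ≤_) (sym eq) r₀≤j
      ... | inj₂ (_ , eq) = subst (r₀ ≤_) (sym eq) (ℕ.m≤n⇒m≤1+n r₀≤j)

  place? : ∀ i → Dec (i <ᶠ σ_ i × r₀ ≤ toℕ i)
  place? i = i Fin.<? σ_ i ×-dec r₀ ℕ.≤? toℕ i

  module NewExcedance (x∉E : ¬ E x) where

    x<y : x <ᶠ y
    x<y = ℕ.≤∧≢⇒< x≤y λ eq → x∉E (subst E (sym (Fin.toℕ-injective eq)) y∈E)

    E⇒Excedance-all : ∀ i → E (σ_ i) → Excedance r₀ σ i
    E⇒Excedance-all i w∈E with i Fin.≟ x
    ... | yes refl = x<y , ℕ.≤-trans r₀≤x x≤y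
    ... | no i≢x   = E⇒Excedance-σ i i≢x w∈E

    Excedance⇒E-all : ∀ i → Excedance r₀ σ i → E (σ_ i)
    Excedance⇒E-all i exc with i Fin.≟ x
    ... | yes refl = y∈E
    ... | no i≢x   = Excedance-σ⇒E i i≢x exc

    den-σ : den (suc r₀) σ ≡ den (suc r₀) π + (count E-above? + toℕ x)
    den-σ = begin
      den (suc r₀) σ
        ≡⟨ den-K σ E⇒Excedance-all Excedance⇒E-all ⟩
      triangle (count E?) + inversions (K ∘ σ_)
        ≡⟨ cong₂ (λ a b → triangle a + b) count-E inversions-σ ⟩
      triangle k + suc k + (inversions Kπ + column (K ∘ σ_) x)
        ≡⟨ solve 4 (λ t c i b → t :+ c :+ (i :+ b) := t :+ i :+ (c :+ b)) refl (triangle k) (suc k) (inversions Kπ) (column (K ∘ σ_) x) ⟩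
      triangle k + inversions Kπ + (suc k + column (K ∘ σ_) x)
        -- The triangle gains `suc k`, the size of E. Its letters below x complete the column of x
        -- to `toℕ x`, and those above x remain.
        ≡⟨ cong₂ _+_ (sym den-π) (begin
             suc k + column (K ∘ σ_) x
               ≡⟨ cong (_+ column (K ∘ σ_) x) (trans (sym count-E) (count-E-split x∉E)) ⟩
             count E-under? + count E-above? + column (K ∘ σ_) x
               ≡⟨ solve 3 (λ a b c → a :+ b :+ c := b :+ (c :+ a)) refl (count E-under?) (count E-above?) (column (K ∘ σ_) x) ⟩
             count E-above? + (column (K ∘ σ_) x + count E-under?)
               ≡⟨ cong (count E-above? +_) inversions-before ⟩
             count E-above? + toℕ x ∎) ⟩
      den (suc r₀) π + (count E-above? + toℕ x) ∎
      where
      open ≡-Reasoning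
      open +-*-Solver
      k = count excedance?

    exc-σ : exc (suc r₀) σ ≡ suc (exc (suc r₀) π)
    exc-σ = trans (exc-count r₀ σ) (trans (count-remove-yes place? x (x<y , r₀≤x)) (cong suc exc-old))

    -- An excedance place ≥ r₀ of σ either has its letter above x, hence in E, or lies in [r₀, x).
    -- Strictness comes from the new excedance place x.
    exc-bound : exc (suc r₀) π + r₀ < count E-above? + toℕ x
    exc-bound = begin
      suc (exc (suc r₀) π) + r₀
        ≡⟨ cong (_+ r₀) (trans (sym exc-σ) (exc-count r₀ σ)) ⟩
      count place? + r₀
        ≤⟨ ℕ.+-monoˡ-≤ r₀ (count-∪ (λ i → E-above? (σ_ i)) between? place? split) ⟩
      count (λ i → E-above? (σ_ i)) + count between? + r₀
        ≡⟨ ℕ.+-assoc _ (count between?) r₀ ⟩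
      count (λ i → E-above? (σ_ i)) + (count between? + r₀)
        ≡⟨ cong₂ _+_ (sym (count-permute E-above? σ)) (count-interval r₀ x r₀≤x) ⟩
      count E-above? + toℕ x ∎
      where
      open ℕ.≤-Reasoning
      between? : ∀ i → Dec (r₀ ≤ toℕ i × i <ᶠ x)
      between? i = r₀ ℕ.≤? toℕ i ×-dec i Fin.<? x
      split : ∀ i → i <ᶠ σ_ i × r₀ ≤ toℕ i → (E (σ_ i) × x <ᶠ σ_ i) ⊎ (r₀ ≤ toℕ i × i <ᶠ x)
      split i (i<w , r₀≤i) with Fin.<-cmp (σ_ i) x
      ... | tri< w<x _ _ = inj₂ (r₀≤i , ℕ.<-trans i<w w<x)
      ... | tri≈ _ w≡x _ = inj₂ (r₀≤i , subst (i <ᶠ_) w≡x i<w)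
      ... | tri> _ _ x<w = inj₁ (Excedance⇒E-all i (i<w , ℕ.≤-trans r₀≤i (ℕ.<⇒≤ i<w)) , x<w)

  module NewFixedPoint (x∈E : E x) where

    y≡x : y ≡ x
    y≡x = Fin.toℕ-injective (ℕ.≤-antisym (y-min x x∈E ℕ.≤-refl) x≤y)

    excedance-σ? : ∀ i → Dec (E (σ_ i) × i ≢ x)
    excedance-σ? i = E? (σ_ i) ×-dec ¬? (i Fin.≟ x)

    E⇒Excedance-all : ∀ i → E (σ_ i) × i ≢ x → Excedance r₀ σ i
    E⇒Excedance-all i (w∈E , i≢x) = E⇒Excedance-σ i i≢x w∈E

    Excedance⇒E-all : ∀ i → Excedance r₀ σ i → E (σ_ i) × i ≢ x
    Excedance⇒E-all i exc = Excedance-σ⇒E i i≢x exc , i≢x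
      where
      i≢x : i ≢ x
      i≢x refl = ℕ.<⇒≢ (proj₁ exc) (sym (cong toℕ y≡x))

    -- Here `y ≡ x` belongs to E but stands at a fixed point, so it has to be declared large in σ;
    -- `K′` differs from `K ∘ σ_` at this single place.
    K′ : Fin (suc m) → ℕ
    K′ i = key (suc m) (excedance-σ? i) (toℕ (σ_ i))

    K′-E : ∀ i → i ≢ x → E (σ_ i) → K′ i ≡ toℕ (σ_ i)
    K′-E i i≢x w∈E = key-yes (suc m) (excedance-σ? i) _ (w∈E , i≢x)

    K′-¬E : ∀ i → ¬ E (σ_ i) → K′ i ≡ suc m + toℕ (σ_ i)
    K′-¬E i w∉E = key-no (suc m) (excedance-σ? i) _ (w∉E ∘ proj₁)

    K′-x : K′ x ≡ suc m + toℕ x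
    K′-x = trans (key-no (suc m) (excedance-σ? x) _ λ (_ , x≢x) → x≢x refl) (cong (λ v → suc m + toℕ v) y≡x)

    K′-p : ∀ j → K′ (p j) ≡ K (σ_ (p j))
    K′-p j with toSum (E? (σ_ (p j)))
    ... | inj₁ w∈E = trans (K′-E (p j) (x≢p j) w∈E) (sym (K-E _ w∈E))
    ... | inj₂ w∉E = trans (K′-¬E (p j) w∉E) (sym (K-¬E _ w∉E))

    -- A letter before x declared larger than the fixed point would be outside E and above x. But a
    -- letter above x at a place before x is an excedance letter.
    column-x : column K′ x ≡ 0
    column-x = count-none (inversion? K′ x) none
      where
      none : ∀ i → ¬ Inversion K′ x i
      none i (i<x , lt) with toSum (E? (σ_ i))
      ... | inj₁ w∈E rewrite K′-x | K′-E i (Fin.<⇒≢ i<x) w∈E =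
        ℕ.<⇒≱ lt (ℕ.≤-trans (ℕ.<⇒≤ (Fin.toℕ<n (σ_ i))) (ℕ.m≤m+n (suc m) _))
      ... | inj₂ w∉E rewrite K′-x | K′-¬E i w∉E with x<w ← ℕ.+-cancelˡ-< (suc m) _ _ lt =
        w∉E (Excedance-σ⇒E i (Fin.<⇒≢ i<x) (ℕ.<-trans i<x x<w , ℕ.≤-trans r₀≤x (ℕ.<⇒≤ x<w)))

    -- Right of x, the letters declared smaller are those of E and those below x. The latter are as
    -- many as the letters above x standing left of x, which all lie in E; together they make up the
    -- letters of E above x.
    after : count (λ j → inversion? K′ j x) ≡ count E-above?
    after = begin
      count (λ j → inversion? K′ j x)
        ≡⟨ count-⊎ later-E? later-small? (λ j → inversion? K′ j x) split₁ E⇒ small⇒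
             (λ i (x<i , w∈E) (_ , w<x) → ℕ.<⇒≱ (ℕ.<-trans (E-above i x<i w∈E) w<x) x≤y) ⟩
      count later-E? + count later-small?
        ≡⟨ cong (count later-E? +_) (count-crossings σ x y≡x) ⟩
      count later-E? + count earlier-large?
        ≡⟨ count-⊎ later-E? earlier-large? (λ i → E-above? (σ_ i)) split₂
             (λ i (x<i , w∈E) → w∈E , ℕ.≤-<-trans x≤y (E-above i x<i w∈E))
             (λ i (i<x , x<w) → Excedance-σ⇒E i (Fin.<⇒≢ i<x) (ℕ.<-trans i<x x<w , ℕ.≤-trans r₀≤x (ℕ.<⇒≤ x<w)) , x<w)
             (λ i (x<i , _) (i<x , _) → ℕ.<-asym x<i i<x) ⟨
      count (λ i → E-above? (σ_ i))
        ≡⟨ count-permute E-above? σ ⟨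
      count E-above? ∎
      where
      open ≡-Reasoning
      later-E? : ∀ i → Dec (x <ᶠ i × E (σ_ i))
      later-E? i = x Fin.<? i ×-dec E? (σ_ i)
      later-small? : ∀ i → Dec (x <ᶠ i × σ_ i <ᶠ x)
      later-small? i = x Fin.<? i ×-dec σ_ i Fin.<? x
      earlier-large? : ∀ i → Dec (i <ᶠ x × x <ᶠ σ_ i)
      earlier-large? i = i Fin.<? x ×-dec x Fin.<? σ_ i
      split₁ : ∀ i → Inversion K′ i x → (x <ᶠ i × E (σ_ i)) ⊎ (x <ᶠ i × σ_ i <ᶠ x)
      split₁ i (x<i , lt) with toSum (E? (σ_ i))
      ... | inj₁ w∈E = inj₁ (x<i , w∈E)
      ... | inj₂ w∉E rewrite K′-x | K′-¬E i w∉E = inj₂ (x<i , ℕ.+-cancelˡ-< (suc m) _ _ lt)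
      E⇒ : ∀ i → x <ᶠ i × E (σ_ i) → Inversion K′ i x
      E⇒ i (x<i , w∈E) rewrite K′-x | K′-E i (Fin.<⇒≢ x<i ∘ sym) w∈E =
        x<i , ℕ.<-≤-trans (Fin.toℕ<n (σ_ i)) (ℕ.m≤m+n (suc m) _)
      small⇒ : ∀ i → x <ᶠ i × σ_ i <ᶠ x → Inversion K′ i x
      small⇒ i (x<i , w<x)
        rewrite K′-x | K′-¬E i (λ w∈E → ℕ.<⇒≱ (ℕ.<-trans (E-above i x<i w∈E) w<x) x≤y) =
        x<i , ℕ.+-monoʳ-< (suc m) w<x
      split₂ : ∀ i → E (σ_ i) × x <ᶠ σ_ i → (x <ᶠ i × E (σ_ i)) ⊎ (i <ᶠ x × x <ᶠ σ_ i)
      split₂ i (w∈E , x<w) with Fin.<-cmp i x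
      ... | tri< i<x _ _  = inj₂ (i<x , x<w)
      ... | tri≈ _ refl _ = contradiction (sym (cong toℕ y≡x)) (ℕ.<⇒≢ x<w)
      ... | tri> _ _ x<i  = inj₁ (x<i , w∈E)

    count-excedance : count excedance-σ? ≡ count excedance?
    count-excedance = trans (count-remove-no excedance-σ? x (λ (_ , x≢x) → x≢x refl))
      (count-cong (λ j → excedance-σ? (p j)) excedance? (λ j → E⇒Excedance j ∘ proj₁)
        (λ j exc → Excedance⇒E j exc , x≢p j))

    den-σ : den (suc r₀) σ ≡ den (suc r₀) π + count E-above?
    den-σ = begin
      den (suc r₀) σ
        ≡⟨ den-inversions r₀ σ (suc m) ℕ.≤-refl excedance-σ? E⇒Excedance-all Excedance⇒E-all ⟩
      triangle (count excedance-σ?) + inversions K′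
        ≡⟨ cong₂ (λ a b → triangle a + b) count-excedance (inversions-remove K′ x) ⟩
      triangle (count excedance?) + (inversions (K′ ∘ p) + (column K′ x + count (λ j → inversion? K′ j x)))
        ≡⟨ cong (triangle (count excedance?) +_) (cong₂ _+_
             (trans (inversions-cong (λ i j → subst₂ _<_ (K′-p j) (K′-p i)) (λ i j → subst₂ _<_ (sym (K′-p j)) (sym (K′-p i)))) old-inversions)
             (cong₂ _+_ column-x after)) ⟩
      triangle (count excedance?) + (inversions Kπ + count E-above?)
        ≡⟨ ℕ.+-assoc (triangle (count excedance?)) _ _ ⟨
      triangle (count excedance?) + inversions Kπ + count E-above?
        ≡⟨ cong (_+ count E-above?) den-π ⟨
      den (suc r₀) π + count E-above? ∎
      where
      open ≡-Reasoning

    exc-σ : exc (suc r₀) σ ≡ exc (suc r₀) π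
    exc-σ = trans (exc-count r₀ σ)
      (trans (count-remove-no place? x (λ (x<y , _) → ℕ.<⇒≢ x<y (sym (cong toℕ y≡x)))) exc-old)

    -- A letter of E above x stands at an excedance place, and either this place is counted by `exc`
    -- or it is one of the r₀ places below r₀.
    exc-bound : count E-above? ≤ exc (suc r₀) π + r₀
    exc-bound = begin
      count E-above?
        ≡⟨ count-permute E-above? σ ⟩
      count (λ i → E-above? (σ_ i))
        ≤⟨ count-∪ place? (λ i → toℕ i ℕ.<? r₀) (λ i → E-above? (σ_ i)) split ⟩
      count place? + count {suc m} (λ i → toℕ i ℕ.<? r₀)
        ≡⟨ cong₂ _+_ (trans (sym (exc-count r₀ σ)) exc-σ) (count-toℕ< {suc m} r₀ (ℕ.≤-trans r₀≤m (ℕ.n≤1+n m))) ⟩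
      exc (suc r₀) π + r₀ ∎
      where
      open ℕ.≤-Reasoning
      split : ∀ i → E (σ_ i) × x <ᶠ σ_ i → (i <ᶠ σ_ i × r₀ ≤ toℕ i) ⊎ toℕ i < r₀
      split i (w∈E , x<w) with toℕ i ℕ.<? r₀
      ... | yes i<r₀ = inj₂ i<r₀
      ... | no i≮r₀  = inj₁ (proj₁ (E⇒Excedance-σ i (λ { refl → ℕ.<⇒≢ x<w (sym (cong toℕ y≡x)) }) w∈E) , ℕ.≮⇒≥ i≮r₀)

-- Insertion at a place below r₀

module Low (r₀ m : ℕ) (r₀≤m : r₀ ≤ m) (π : Permutation′ m) where
  open Enlarged r₀ m r₀≤m π

  origin : Fin (suc m)
  origin = fromℕ< (s≤s r₀≤m)

  toℕ-origin : toℕ origin ≡ r₀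
  toℕ-origin = Fin.toℕ-fromℕ< (s≤s r₀≤m)

  open At origin (ℕ.≤-reflexive (sym toℕ-origin)) using (y; p; y∈E; y-min)
    renaming (σ to σ₀) public
  private
    module A = At origin (ℕ.≤-reflexive (sym toℕ-origin))
    module I = InsertionStatistics r₀ m r₀≤m π origin (ℕ.≤-reflexive (sym toℕ-origin))

  <origin : ∀ (i : Fin (suc m)) → i <ᶠ origin → toℕ i < r₀
  <origin i = subst (toℕ i <_) toℕ-origin

  Initial : Fin (suc m) → Set
  Initial v = (σ₀ ⟨$⟩ˡ v) ≤ᶠ origin

  initial-σ₀ : ∀ i → i ≤ᶠ origin → Initial (σ₀ ⟨$⟩ʳ i)
  initial-σ₀ i = subst (_≤ᶠ origin) (sym (Perm.inverseˡ σ₀))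

  -- A letter ≥ r₀ before place r₀ is automatically an excedance letter, and place r₀ itself holds
  -- `y`. So up to place r₀ membership in E can be read from the letter alone, which is why these
  -- letters may be rearranged without changing E.
  initial-E : ∀ v → Initial v → r₀ ≤ toℕ v → E v
  initial-E v init r₀≤v with (σ₀ ⟨$⟩ˡ v) Fin.≟ origin
  ... | yes eq = subst E (trans (cong (σ₀ ⟨$⟩ʳ_) (sym eq)) (Perm.inverseʳ σ₀)) y∈E
  ... | no neq = subst E (Perm.inverseʳ σ₀) (A.Excedance-σ⇒E (σ₀ ⟨$⟩ˡ v) neq
    (subst (Exceeds) (sym (Perm.inverseʳ σ₀))
      (ℕ.<-≤-trans (<origin _ (ℕ.≤∧≢⇒< init (neq ∘ Fin.toℕ-injective))) r₀≤v , r₀≤v)))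
    where
    Exceeds : Fin (suc m) → Set
    Exceeds w = toℕ (σ₀ ⟨$⟩ˡ v) < toℕ w × r₀ ≤ toℕ w

  y-min-K : ∀ v → Initial v → K y ≤ K v
  y-min-K v init with toSum (E? v)
  ... | inj₂ v∉E = ℕ.<⇒≤ (E<¬E y v y∈E v∉E)
  ... | inj₁ v∈E rewrite K-E y y∈E | K-E v v∈E = y-min v v∈E (ℕ.≤-trans (ℕ.≤-reflexive toℕ-origin) (E⇒≥r₀ v v∈E))

  module Lower (q : Fin (suc m)) (q<r₀ : toℕ q < r₀) where

    a : Fin (suc m)
    a = σ₀ ⟨$⟩ʳ q

    q≤origin : q ≤ᶠ origin
    q≤origin = ℕ.≤-trans (ℕ.<⇒≤ q<r₀) (ℕ.≤-reflexive (sym toℕ-origin))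

    -- σ₀ has its K-least initial letter at place r₀. Put the letter a of place q there instead, and
    -- keep the relative order of the letters at the places before r₀.
    Sₗ : Fin (suc m) → Set
    Sₗ v = Initial v × K v ≤ K a

    open Rotation (λ v → (σ₀ ⟨$⟩ˡ v) Fin.≤? origin ×-dec K v ℕ.≤? K a) K-injective
                  {a} (initial-σ₀ q q≤origin , ℕ.≤-refl) (λ _ → proj₂)
                  using () renaming (rotation to ρ; rotation-Rotates to ρ-Rotates; Rotates-functional to Sₗ-functional) public

    y∈S : Sₗ y
    y∈S = initial-σ₀ origin ℕ.≤-refl , y-min-K a (initial-σ₀ q q≤origin)

    opaque
      σ : Permutation′ (suc m)
      σ = σ₀ Perm.∘ₚ Perm.flip ρ

      σ-Rotates : ∀ i → Rotates Sₗ K a (σ ⟨$⟩ʳ i) (σ₀ ⟨$⟩ʳ i)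
      σ-Rotates i = subst (Rotates Sₗ K a (σ ⟨$⟩ʳ i)) (Perm.inverseʳ ρ) (ρ-Rotates (σ ⟨$⟩ʳ i))

    σ-origin : σ ⟨$⟩ʳ origin ≡ a
    σ-origin with σ-Rotates origin
    ... | wraps eq _ _ = eq
    ... | steps _ u∈S _ u<y _ = contradiction u<y (ℕ.≤⇒≯ (y-min-K _ (proj₁ u∈S)))
    ... | fixes u∉S eq = contradiction (subst Sₗ eq y∈S) u∉S

    a≢y : a ≢ y
    a≢y eq = ℕ.<⇒≢ q<r₀ (trans (cong toℕ (⟨$⟩ʳ-injective σ₀ eq)) toℕ-origin)

    data Lowered (w u : Fin (suc m)) : Set where
      lowered : Sₗ w → Sₗ u → K u < K w → (∀ v → Sₗ v → K u < K v → K w ≤ K v) → Lowered w u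
      kept    : K a < K w → u ≡ w → Lowered w u

    σ-Lowered : ∀ i → i <ᶠ origin → Lowered (σ₀ ⟨$⟩ʳ i) (σ ⟨$⟩ʳ i)
    σ-Lowered i i<o with σ-Rotates i
    ... | wraps _ w∈S min = contradiction (⟨$⟩ʳ-injective σ₀ (K-injective (ℕ.≤-antisym (min y y∈S) (y-min-K _ (proj₁ w∈S)))))
                                          (Fin.<⇒≢ i<o)
    ... | steps _ u∈S w∈S u<w next = lowered w∈S u∈S u<w next
    ... | fixes u∉S eq = kept (ℕ.≰⇒> λ le → u∉S (subst Sₗ eq (initial-σ₀ i (ℕ.<⇒≤ i<o) , le))) (sym eq)

    σ-after : ∀ i → origin <ᶠ i → σ ⟨$⟩ʳ i ≡ σ₀ ⟨$⟩ʳ i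
    σ-after i o<i with σ-Rotates i
    ... | wraps _ w∈S _ = contradiction (subst (_≤ᶠ origin) (Perm.inverseˡ σ₀) (proj₁ w∈S)) (ℕ.<⇒≱ o<i)
    ... | steps _ _ w∈S _ _ = contradiction (subst (_≤ᶠ origin) (Perm.inverseˡ σ₀) (proj₁ w∈S)) (ℕ.<⇒≱ o<i)
    ... | fixes _ eq = sym eq

    σ-initial : ∀ i → i ≤ᶠ origin → Initial (σ ⟨$⟩ʳ i)
    σ-initial i i≤o with i Fin.≟ origin
    ... | yes refl = subst Initial (sym σ-origin) (initial-σ₀ q q≤origin)
    ... | no i≢o with σ-Lowered i (ℕ.≤∧≢⇒< i≤o (i≢o ∘ Fin.toℕ-injective))
    ...   | lowered _ u∈S _ _ = proj₁ u∈S
    ...   | kept _ eq = subst Initial (sym eq) (initial-σ₀ i i≤o)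

    E⇒Excedance-σ : ∀ i → E (σ ⟨$⟩ʳ i) → Excedance r₀ σ i
    E⇒Excedance-σ i w∈E with Fin.<-cmp i origin
    ... | tri< i<o _ _ = ℕ.<-≤-trans (<origin i i<o) (E⇒≥r₀ _ w∈E) , E⇒≥r₀ _ w∈E
    -- `a ∈ E` alone gives only `r₀ ≤ a`. The strict inequality needed at place r₀ comes from `y`,
    -- the least letter of E, which differs from `a`.
    ... | tri≈ _ refl _ = subst (λ v → origin <ᶠ v × r₀ ≤ toℕ v) (sym σ-origin)
      (ℕ.≤-<-trans (ℕ.≤-trans (ℕ.≤-reflexive toℕ-origin) (E⇒≥r₀ y y∈E)) y<a , E⇒≥r₀ a a∈E)
      where
      a∈E = subst E σ-origin w∈E
      y<a : y <ᶠ a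
      y<a = ℕ.≤∧≢⇒< (y-min a a∈E (ℕ.≤-trans (ℕ.≤-reflexive toℕ-origin) (E⇒≥r₀ a a∈E)))
                    (a≢y ∘ sym ∘ Fin.toℕ-injective)
    ... | tri> _ i≢o o<i = subst (λ v → i <ᶠ v × r₀ ≤ toℕ v) (sym (σ-after i o<i))
      (A.E⇒Excedance-σ i i≢o (subst E (σ-after i o<i) w∈E))

    Excedance-σ⇒E : ∀ i → Excedance r₀ σ i → E (σ ⟨$⟩ʳ i)
    Excedance-σ⇒E i exc with i Fin.≤? origin
    ... | yes i≤o = initial-E _ (σ-initial i i≤o) (proj₂ exc)
    ... | no i≰o = subst E (sym eq) (A.Excedance-σ⇒E i (Fin.<⇒≢ o<i ∘ sym) (subst (λ v → i <ᶠ v × r₀ ≤ toℕ v) eq exc))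
      where
      o<i = ℕ.≰⇒> i≰o
      eq = σ-after i o<i

    -- The inverse rotation breaks the order of keys only at the element it wraps, and this is `y`,
    -- which stands at place r₀ in `σ₀`.
    σ-mono : ∀ i j → i <ᶠ origin → j <ᶠ origin → K (σ₀ ⟨$⟩ʳ i) < K (σ₀ ⟨$⟩ʳ j) → K (σ ⟨$⟩ʳ i) < K (σ ⟨$⟩ʳ j)
    σ-mono i j i<o j<o lt with σ-Lowered i i<o | σ-Lowered j j<o
    ... | lowered w∈S _ u<w _ | lowered _ _ _ next = ℕ.<-≤-trans u<w (ℕ.≮⇒≥ λ u′<w → ℕ.<⇒≱ lt (next _ w∈S u′<w))
    ... | lowered _ _ u<w _ | kept _ eq rewrite eq = ℕ.<-trans u<w lt
    ... | kept a<w _ | lowered w′∈S _ _ _ = contradiction (ℕ.<-trans a<w lt) (ℕ.≤⇒≯ (proj₂ w′∈S))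
    ... | kept _ eq | kept _ eq′ rewrite eq | eq′ = lt

    σ-cancel : ∀ i j → i <ᶠ origin → j <ᶠ origin → K (σ ⟨$⟩ʳ i) < K (σ ⟨$⟩ʳ j) → K (σ₀ ⟨$⟩ʳ i) < K (σ₀ ⟨$⟩ʳ j)
    σ-cancel i j i<o j<o lt with ℕ.<-cmp (K (σ₀ ⟨$⟩ʳ i)) (K (σ₀ ⟨$⟩ʳ j))
    ... | tri< w<w′ _ _ = w<w′
    ... | tri≈ _ eq _ = contradiction (cong (λ i → K (σ ⟨$⟩ʳ i)) (⟨$⟩ʳ-injective σ₀ (K-injective eq))) (ℕ.<⇒≢ lt)
    ... | tri> _ _ w′<w = contradiction lt (ℕ.<-asym (σ-mono j i j<o i<o w′<w))

    K₀ K₁ : Fin (suc m) → ℕ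
    K₀ i = K (σ₀ ⟨$⟩ʳ i)
    K₁ i = K (σ ⟨$⟩ʳ i)

    -- Both words have the same letters, and agree from position j onwards.
    column-after : ∀ j → origin <ᶠ j → column K₁ j ≡ column K₀ j
    column-after j o<j = ℕ.+-cancelʳ-≡ (count (later? K₀)) _ _ (begin
      column K₁ j + count (later? K₀)
        ≡⟨ cong (column K₁ j +_) (count-cong (later? K₀) (later? K₁) (λ i (j≤i , lt) → j≤i , subst (K₀ j <_) (sym (same i j≤i)) lt)
             (λ i (j≤i , lt) → j≤i , subst (K₀ j <_) (same i j≤i) lt)) ⟩
      column K₁ j + count (later? K₁)
        ≡⟨ count-⊎ (inversion? K₁ j) (later? K₁) (λ i → K₀ j ℕ.<? K₁ i) split₁
             (λ i (_ , lt) → subst (_< K₁ i) (same j ℕ.≤-refl) lt) (λ _ → proj₂) (λ i (i<j , _) (j≤i , _) → ℕ.<⇒≱ i<j j≤i) ⟨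
      count (λ i → K₀ j ℕ.<? K₁ i)
        ≡⟨ count-permute (λ v → K₀ j ℕ.<? K v) σ ⟨
      count (λ v → K₀ j ℕ.<? K v)
        ≡⟨ count-permute (λ v → K₀ j ℕ.<? K v) σ₀ ⟩
      count (λ i → K₀ j ℕ.<? K₀ i)
        ≡⟨ count-⊎ (inversion? K₀ j) (later? K₀) (λ i → K₀ j ℕ.<? K₀ i) split₀
             (λ _ → proj₂) (λ _ → proj₂) (λ i (i<j , _) (j≤i , _) → ℕ.<⇒≱ i<j j≤i) ⟩
      column K₀ j + count (later? K₀) ∎)
      where
      open ≡-Reasoning
      later? : (w : Fin (suc m) → ℕ) → ∀ i → Dec (j ≤ᶠ i × K₀ j < w i)
      later? w i = j Fin.≤? i ×-dec K₀ j ℕ.<? w i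
      same : ∀ i → j ≤ᶠ i → K₁ i ≡ K₀ i
      same i j≤i = cong K (σ-after i (ℕ.<-≤-trans o<j j≤i))
      split₁ : ∀ i → K₀ j < K₁ i → Inversion K₁ j i ⊎ (j ≤ᶠ i × K₀ j < K₁ i)
      split₁ i lt with i Fin.<? j
      ... | yes i<j = inj₁ (i<j , subst (_< K₁ i) (sym (same j ℕ.≤-refl)) lt)
      ... | no i≮j  = inj₂ (ℕ.≮⇒≥ i≮j , lt)
      split₀ : ∀ i → K₀ j < K₀ i → Inversion K₀ j i ⊎ (j ≤ᶠ i × K₀ j < K₀ i)
      split₀ i lt with i Fin.<? j
      ... | yes i<j = inj₁ (i<j , lt)
      ... | no i≮j  = inj₂ (ℕ.≮⇒≥ i≮j , lt)

    larger? : ∀ i → Dec (i <ᶠ origin × K a < K (σ₀ ⟨$⟩ʳ i))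
    larger? i = i Fin.<? origin ×-dec K a ℕ.<? K (σ₀ ⟨$⟩ʳ i)

    larger-σ⇒ : ∀ i → i <ᶠ origin → K a < K₁ i → K a < K₀ i
    larger-σ⇒ i i<o lt with σ-Lowered i i<o
    ... | lowered _ u∈S _ _ = contradiction lt (ℕ.≤⇒≯ (proj₂ u∈S))
    ... | kept a<w _ = a<w

    larger-σ₀⇒ : ∀ i → i <ᶠ origin → K a < K₀ i → K a < K₁ i
    larger-σ₀⇒ i i<o lt with σ-Lowered i i<o
    ... | lowered w∈S _ _ _ = contradiction lt (ℕ.≤⇒≯ (proj₂ w∈S))
    ... | kept a<w eq rewrite eq = a<w

    column-origin : column K₁ origin ≡ count larger?
    column-origin = count-cong (inversion? K₁ origin) larger?
      (λ i (i<o , lt) → i<o , larger-σ⇒ i i<o (subst (λ v → K v < K₁ i) σ-origin lt))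
      (λ i (i<o , lt) → i<o , subst (λ v → K v < K₁ i) (sym σ-origin) (larger-σ₀⇒ i i<o lt))

    -- No letter of E is below r₀, so `y` has the least key among the first places and forms an
    -- inversion with each of the r₀ letters before it.
    column₀-origin : column K₀ origin ≡ r₀
    column₀-origin = begin
      column K₀ origin                        ≡⟨ ℕ.+-identityʳ _ ⟨
      column K₀ origin + 0                    ≡⟨ cong (column K₀ origin +_) (count-none I.E-under?
                                                   (λ v (v∈E , v<o) → ℕ.<⇒≱ (<origin v v<o) (E⇒≥r₀ v v∈E))) ⟨
      column K₀ origin + count I.E-under?     ≡⟨ I.inversions-before ⟩
      toℕ origin                              ≡⟨ toℕ-origin ⟩
      r₀ ∎
      where
      open ≡-Reasoning

    columns : ∀ j → j ≢ origin → column K₁ j ≡ column K₀ j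
    columns j j≢o with Fin.<-cmp j origin
    ... | tri< j<o _ _ = column-cong j (λ i i<j → σ-cancel j i j<o (ℕ.<-trans i<j j<o))
                                       (λ i i<j → σ-mono j i j<o (ℕ.<-trans i<j j<o))
    ... | tri≈ _ j≡o _ = contradiction j≡o j≢o
    ... | tri> _ _ o<j = column-after j o<j

    -- Of all columns only the one at place r₀ changes: its value drops from the maximum r₀ to the
    -- number of earlier letters declared larger than `a`.
    inversions-σ : inversions K₁ ≡ inversions A.Kπ + count larger?
    inversions-σ = ℕ.+-cancelʳ-≡ r₀ _ _ (begin
      inversions K₁ + r₀                             ≡⟨ cong (inversions K₁ +_) column₀-origin ⟨
      inversions K₁ + column K₀ origin               ≡⟨ inversions-change-column origin columns ⟩
      inversions K₀ + column K₁ origin               ≡⟨ cong₂ _+_ I.inversions-σ column-origin ⟩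
      inversions A.Kπ + column K₀ origin + count larger? ≡⟨ cong (λ c → inversions A.Kπ + c + count larger?) column₀-origin ⟩
      inversions A.Kπ + r₀ + count larger?
        ≡⟨ solve 3 (λ i r l → i :+ r :+ l := i :+ l :+ r) refl (inversions A.Kπ) r₀ (count larger?) ⟩
      inversions A.Kπ + count larger? + r₀ ∎)
      where
      open ≡-Reasoning
      open +-*-Solver

    den-σ : den (suc r₀) σ ≡ den (suc r₀) π + (count E? + count larger?)
    den-σ = begin
      den (suc r₀) σ
        ≡⟨ den-K σ E⇒Excedance-σ Excedance-σ⇒E ⟩
      triangle (count E?) + inversions K₁
        ≡⟨ cong₂ (λ a b → triangle a + b) I.count-E inversions-σ ⟩
      triangle k + suc k + (inversions A.Kπ + count larger?)
        ≡⟨ solve 4 (λ t c i b → t :+ c :+ (i :+ b) := t :+ i :+ (c :+ b)) refl (triangle k) (suc k) (inversions A.Kπ) (count larger?) ⟩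
      triangle k + inversions A.Kπ + (suc k + count larger?)
        ≡⟨ cong₂ (λ a b → a + (b + count larger?)) I.den-π I.count-E ⟨
      den (suc r₀) π + (count E? + count larger?) ∎
      where
      open ≡-Reasoning
      open +-*-Solver
      k = count excedance?

    place? : ∀ i → Dec (i <ᶠ (σ ⟨$⟩ʳ i) × r₀ ≤ toℕ i)
    place? i = i Fin.<? (σ ⟨$⟩ʳ i) ×-dec r₀ ℕ.≤? toℕ i

    old-places : count (λ j → place? (p j)) ≡ exc (suc r₀) π
    old-places = trans (count-cong (λ j → place? (p j)) I.old?
      (λ j (lt , le) → subst (p j <ᶠ_) (σ-after (p j) (after j le)) lt , le)
      (λ j (lt , le) → subst (p j <ᶠ_) (sym (σ-after (p j) (after j le))) lt , le)) I.exc-old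
      where
      after : ∀ j → r₀ ≤ toℕ (p j) → origin <ᶠ p j
      after j le = ℕ.≤∧≢⇒< (ℕ.≤-trans (ℕ.≤-reflexive toℕ-origin) le) (I.x≢p j ∘ sym ∘ Fin.toℕ-injective)

    exc-σ-¬E : ¬ E a → exc (suc r₀) σ ≡ exc (suc r₀) π
    exc-σ-¬E a∉E = trans (exc-count r₀ σ) (trans (count-remove-no place? origin none) old-places)
      where
      none : ¬ (origin <ᶠ (σ ⟨$⟩ʳ origin) × r₀ ≤ toℕ origin)
      none (lt , le) = a∉E (subst E σ-origin (Excedance-σ⇒E origin (lt , ℕ.≤-trans le (ℕ.<⇒≤ lt))))

    exc-σ-E : E a → exc (suc r₀) σ ≡ suc (exc (suc r₀) π)
    exc-σ-E a∈E = trans (exc-count r₀ σ) (trans (count-remove-yes place? origin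
      (proj₁ (E⇒Excedance-σ origin (subst E (sym σ-origin) a∈E)) , ℕ.≤-reflexive (sym toℕ-origin)))
      (cong suc old-places))

    early? : ∀ i → Dec (toℕ i < r₀ × E (σ ⟨$⟩ʳ i))
    early? i = toℕ i ℕ.<? r₀ ×-dec E? (σ ⟨$⟩ʳ i)

    count-E-places : count E? ≡ count place? + count early?
    count-E-places = trans (count-permute E? σ) (count-⊎ place? early? (λ i → E? (σ ⟨$⟩ʳ i)) split
      (λ i (lt , le) → Excedance-σ⇒E i (lt , ℕ.≤-trans le (ℕ.<⇒≤ lt))) (λ _ → proj₂)
      (λ i (_ , le) (lt , _) → ℕ.<⇒≱ lt le))
      where
      split : ∀ i → E (σ ⟨$⟩ʳ i) → (i <ᶠ (σ ⟨$⟩ʳ i) × r₀ ≤ toℕ i) ⊎ (toℕ i < r₀ × E (σ ⟨$⟩ʳ i))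
      split i w∈E with toℕ i ℕ.<? r₀
      ... | yes i<r₀ = inj₂ (i<r₀ , w∈E)
      ... | no i≮r₀  = inj₁ (proj₁ (E⇒Excedance-σ i w∈E) , ℕ.≮⇒≥ i≮r₀)

    count-r₀ : count {suc m} (λ i → toℕ i ℕ.<? r₀) ≡ r₀
    count-r₀ = count-toℕ< {suc m} r₀ (ℕ.≤-trans r₀≤m (ℕ.n≤1+n m))

    -- No letter of E is declared larger than an `a` outside E, so `early?` and `larger?` hold at
    -- different places below r₀, at most r₀ in total. The remaining letters of E are counted by
    -- `exc`.
    exc-bound-¬E : ¬ E a → count E? + count larger? ≤ exc (suc r₀) π + r₀
    exc-bound-¬E a∉E = begin
      count E? + count larger?
        ≡⟨ cong (_+ count larger?) count-E-places ⟩
      count place? + count early? + count larger?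
        ≡⟨ ℕ.+-assoc (count place?) _ _ ⟩
      count place? + (count early? + count larger?)
        ≡⟨ cong (count place? +_) (count-⊎ early? larger? (λ i → early? i ⊎-dec larger? i)
             (λ _ e → e) (λ _ → inj₁) (λ _ → inj₂) disjoint) ⟨
      count place? + count (λ i → early? i ⊎-dec larger? i)
        ≤⟨ ℕ.+-monoʳ-≤ (count place?) (count-mono (λ i → early? i ⊎-dec larger? i) (λ i → toℕ i ℕ.<? r₀)
             (λ i → [ proj₁ , <origin i ∘ proj₁ ])) ⟩
      count place? + count {suc m} (λ i → toℕ i ℕ.<? r₀)
        ≡⟨ cong₂ _+_ (trans (sym (exc-count r₀ σ)) (exc-σ-¬E a∉E)) count-r₀ ⟩
      exc (suc r₀) π + r₀ ∎
      where
      open ℕ.≤-Reasoning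
      disjoint : ∀ i → toℕ i < r₀ × E (σ ⟨$⟩ʳ i) → ¬ (i <ᶠ origin × K a < K₀ i)
      disjoint i (_ , w∈E) (i<o , lt) = ℕ.<-asym (larger-σ₀⇒ i i<o lt) (E<¬E _ a w∈E a∉E)

    -- Every letter outside E is declared larger than an `a` in E, so now `early?` and `larger?`
    -- cover all r₀ places below r₀; the extra 1 is the new excedance place r₀.
    exc-bound-E : E a → exc (suc r₀) π + r₀ < count E? + count larger?
    exc-bound-E a∈E = begin
      suc (exc (suc r₀) π) + r₀
        ≡⟨ cong₂ _+_ (trans (sym (exc-σ-E a∈E)) (exc-count r₀ σ)) (sym count-r₀) ⟩
      count place? + count {suc m} (λ i → toℕ i ℕ.<? r₀)
        ≤⟨ ℕ.+-monoʳ-≤ (count place?) (count-∪ early? larger? (λ i → toℕ i ℕ.<? r₀) split) ⟩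
      count place? + (count early? + count larger?)
        ≡⟨ ℕ.+-assoc (count place?) _ _ ⟨
      count place? + count early? + count larger?
        ≡⟨ cong (_+ count larger?) count-E-places ⟨
      count E? + count larger? ∎
      where
      open ℕ.≤-Reasoning
      split : ∀ i → toℕ i < r₀ → (toℕ i < r₀ × E (σ ⟨$⟩ʳ i)) ⊎ (i <ᶠ origin × K a < K₀ i)
      split i i<r₀ with toSum (E? (σ ⟨$⟩ʳ i))
      ... | inj₁ w∈E = inj₁ (i<r₀ , w∈E)
      ... | inj₂ w∉E = inj₂ (i<o , larger-σ⇒ i i<o (E<¬E a _ a∈E w∉E))
        where i<o = subst (toℕ i <_) (sym toℕ-origin) i<r₀

-- Recovering the place of insertion

-- For i ≥ r₀ : no excedance letter of σ lies in the interval [i , σ i). The place of an insertion at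
-- x ≥ r₀ is the largest special one, while an insertion below r₀ leaves no special place ≥ r₀.
Special : Permutation′ n → Fin n → Set
Special σ i = i ≤ᶠ (σ ⟨$⟩ʳ i) × (∀ l → l <ᶠ (σ ⟨$⟩ʳ l) → i ≤ᶠ (σ ⟨$⟩ʳ l) → (σ ⟨$⟩ʳ i) ≤ᶠ (σ ⟨$⟩ʳ l))

Special-resp : (σ τ : Permutation′ n) → σ ≈ τ → ∀ i → Special σ i → Special τ i
Special-resp σ τ σ≈τ i (i≤ , min) = subst (i ≤ᶠ_) (σ≈τ i) i≤ ,
  λ l l< i≤l → subst₂ _≤ᶠ_ (σ≈τ i) (σ≈τ l) (min l (subst (l <ᶠ_) (sym (σ≈τ l)) l<) (subst (i ≤ᶠ_) (sym (σ≈τ l)) i≤l))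

Excedance-resp : ∀ r₀ (σ τ : Permutation′ n) → σ ≈ τ → ∀ i → Excedance r₀ σ i → Excedance r₀ τ i
Excedance-resp r₀ σ τ σ≈τ i = subst (λ v → toℕ i < toℕ v × r₀ ≤ toℕ v) (σ≈τ i)

module Recovery (r₀ m : ℕ) (r₀≤m : r₀ ≤ m) where

  module HighSpecial (π : Permutation′ m) (x : Fin (suc m)) (r₀≤x : r₀ ≤ toℕ x) where
    open Enlarged r₀ m r₀≤m π
    open At x r₀≤x

    special : Special σ x
    special = x≤y , min
      where
      min : ∀ l → l <ᶠ (σ ⟨$⟩ʳ l) → x ≤ᶠ (σ ⟨$⟩ʳ l) → y ≤ᶠ (σ ⟨$⟩ʳ l)
      min l l< x≤ with l Fin.≟ x
      ... | yes refl = ℕ.≤-refl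
      ... | no l≢x   = y-min _ (Excedance-σ⇒E l l≢x (l< , ℕ.≤-trans r₀≤x x≤)) x≤

    not-special : ∀ i → x <ᶠ i → ¬ Special σ i
    not-special i x<i (i≤w , min) with toSum (E? (σ ⟨$⟩ʳ i))
    ... | inj₂ w∉E = ℕ.<⇒≱ (¬E-below i x<i w∉E) i≤w
    ... | inj₁ w∈E with v , v∈E , i≤v , v<w ← E-between i x<i w∈E =
      ℕ.<⇒≱ v<w (subst ((σ ⟨$⟩ʳ i) ≤ᶠ_) σl≡v (min l (subst (l <ᶠ_) (sym σl≡v) l<v) (subst (i ≤ᶠ_) (sym σl≡v) i≤v)))
      where
      l = σ ⟨$⟩ˡ v
      σl≡v : σ ⟨$⟩ʳ l ≡ v
      σl≡v = Perm.inverseʳ σ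
      l<v : l <ᶠ v
      -- Membership of `v` in E gives an excedance place except at x, which may be a fixed point;
      -- there `x < i ≤ v` decides.
      l<v with l Fin.≟ x
      ... | yes l≡x = subst (_<ᶠ v) (sym l≡x) (ℕ.<-≤-trans x<i i≤v)
      ... | no l≢x  = subst (l <ᶠ_) σl≡v (proj₁ (E⇒Excedance-σ l l≢x (subst E (sym σl≡v) v∈E)))

  module LowSpecial (π : Permutation′ m) (q : Fin (suc m)) (q<r₀ : toℕ q < r₀) where
    open Enlarged r₀ m r₀≤m π
    open Low r₀ m r₀≤m π
    open Lower q q<r₀
    private
      module A = At origin (ℕ.≤-reflexive (sym toℕ-origin))

    letter-special : ∀ i v → E v → Special σ i → i ≤ᶠ v → (σ ⟨$⟩ʳ i) ≤ᶠ v
    letter-special i v v∈E (_ , min) i≤v = subst ((σ ⟨$⟩ʳ i) ≤ᶠ_) σl≡v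
      (min (σ ⟨$⟩ˡ v) (proj₁ (E⇒Excedance-σ _ (subst E (sym σl≡v) v∈E))) (subst (i ≤ᶠ_) (sym σl≡v) i≤v))
      where
      σl≡v : σ ⟨$⟩ʳ (σ ⟨$⟩ˡ v) ≡ v
      σl≡v = Perm.inverseʳ σ

    -- At place r₀ the excedance letter `y` lies in [r₀, a) as soon as `r₀ ≤ a`. Beyond r₀ the
    -- letters agree with those of `σ₀`, where a letter is either below its place or has jumped over
    -- a letter of E, and in σ every letter of E stands at an excedance place.
    not-special : ∀ i → r₀ ≤ toℕ i → ¬ Special σ i
    not-special i r₀≤i special with i Fin.≟ origin
    ... | yes refl = a≢y (Fin.toℕ-injective (ℕ.≤-antisym a≤y (y-min a a∈E o≤a)))
      where
      o≤a : origin ≤ᶠ a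
      o≤a = subst (origin ≤ᶠ_) σ-origin (proj₁ special)
      a∈E : E a
      a∈E = initial-E a (initial-σ₀ q q≤origin) (ℕ.≤-trans (ℕ.≤-reflexive (sym toℕ-origin)) o≤a)
      a≤y : a ≤ᶠ y
      a≤y = subst (_≤ᶠ y) σ-origin (letter-special origin y y∈E special
        (ℕ.≤-trans (ℕ.≤-reflexive toℕ-origin) (E⇒≥r₀ y y∈E)))
    ... | no i≢o = after (toSum (E? (σ₀ ⟨$⟩ʳ i)))
      where
      o<i : origin <ᶠ i
      o<i = ℕ.≤∧≢⇒< (ℕ.≤-trans (ℕ.≤-reflexive toℕ-origin) r₀≤i) (i≢o ∘ sym ∘ Fin.toℕ-injective)
      after : E (σ₀ ⟨$⟩ʳ i) ⊎ ¬ E (σ₀ ⟨$⟩ʳ i) → _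
      after (inj₂ w∉E) = ℕ.<⇒≱ (A.¬E-below i o<i w∉E) (subst (i ≤ᶠ_) (σ-after i o<i) (proj₁ special))
      after (inj₁ w∈E) with v , v∈E , i≤v , v<w ← A.E-between i o<i w∈E =
        ℕ.<⇒≱ v<w (subst (_≤ᶠ v) (σ-after i o<i) (letter-special i v v∈E special i≤v))

    initial-σ⁻¹ : ∀ v → Initial v → (σ ⟨$⟩ˡ v) ≤ᶠ origin
    initial-σ⁻¹ v init = ℕ.≮⇒≥ λ o<i → ℕ.<⇒≱ o<i (subst (_≤ᶠ origin) (eq o<i) init)
      where
      eq : origin <ᶠ (σ ⟨$⟩ˡ v) → σ₀ ⟨$⟩ˡ v ≡ σ ⟨$⟩ˡ v
      eq o<i = trans (cong (σ₀ ⟨$⟩ˡ_) (trans (sym (Perm.inverseʳ σ)) (σ-after _ o<i))) (Perm.inverseˡ σ₀)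

  -- E can be read off the result and x: it consists of the excedance letters at places other than
  -- x, together with the letter at x.
  E-high : ∀ π π′ x r≤x r≤x′ → Enlarged.At.σ r₀ m r₀≤m π x r≤x ≈ Enlarged.At.σ r₀ m r₀≤m π′ x r≤x′ →
           ∀ v → Enlarged.E r₀ m r₀≤m π v → Enlarged.E r₀ m r₀≤m π′ v
  E-high π π′ x r≤x r≤x′ σ≈σ′ v v∈E = subst X′.E (trans (sym (σ≈σ′ l)) σl≡v) (σ′l∈E (l Fin.≟ x))
    where
    module X  = Enlarged r₀ m r₀≤m π
    module X′ = Enlarged r₀ m r₀≤m π′
    module A  = X.At x r≤x
    module A′ = X′.At x r≤x′
    l = A.σ ⟨$⟩ˡ v
    σl≡v : A.σ ⟨$⟩ʳ l ≡ v
    σl≡v = Perm.inverseʳ A.σ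
    σ′l∈E : Dec (l ≡ x) → X′.E (A′.σ ⟨$⟩ʳ l)
    σ′l∈E (yes l≡x) = subst (λ i → X′.E (A′.σ ⟨$⟩ʳ i)) (sym l≡x) A′.y∈E
    σ′l∈E (no l≢x)  = A′.Excedance-σ⇒E l l≢x (Excedance-resp r₀ A.σ A′.σ σ≈σ′ l
      (A.E⇒Excedance-σ l l≢x (subst X.E (sym σl≡v) v∈E)))

  -- Equal E means equal rotations, and undoing the rotation leaves a plain insertion of the top
  -- letter at x.
  high-injective : ∀ π π′ x r≤x r≤x′ → Enlarged.At.σ r₀ m r₀≤m π x r≤x ≈ Enlarged.At.σ r₀ m r₀≤m π′ x r≤x′ → π ≈ π′
  high-injective π π′ x r≤x r≤x′ σ≈σ′ j =
    Fin.punchIn-injective X.top _ _ (trans (sym (Perm.insert-punchIn x X.top π j))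
      (trans (inserted (punchIn x j)) (Perm.insert-punchIn x X.top π′ j)))
    where
    module X  = Enlarged r₀ m r₀≤m π
    module X′ = Enlarged r₀ m r₀≤m π′
    module A  = X.At x r≤x
    module A′ = X′.At x r≤x′
    inserted : ∀ i → insert x X.top π ⟨$⟩ʳ i ≡ insert x X.top π′ ⟨$⟩ʳ i
    inserted i = A.Rotates-injective (A.σ-Rotates i)
      (subst (Rotates A.S toℕ X.top (insert x X.top π′ ⟨$⟩ʳ i)) (sym (σ≈σ′ i))
        (Rotates-resp (λ v (v∈E , x≤v) → E-high π′ π x r≤x′ r≤x (λ i → sym (σ≈σ′ i)) v v∈E , x≤v)
                      (λ v (v∈E , x≤v) → E-high π π′ x r≤x r≤x′ σ≈σ′ v v∈E , x≤v) (λ _ → refl) (A′.σ-Rotates i)))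

  module LowPair (π π′ : Permutation′ m) (q q′ : Fin (suc m)) (q<r₀ : toℕ q < r₀) (q′<r₀ : toℕ q′ < r₀)
                 (σ≈σ′ : Low.Lower.σ r₀ m r₀≤m π q q<r₀ ≈ Low.Lower.σ r₀ m r₀≤m π′ q′ q′<r₀) where
    module X  = Enlarged r₀ m r₀≤m π
    module X′ = Enlarged r₀ m r₀≤m π′
    module L  = Low r₀ m r₀≤m π
    module L′ = Low r₀ m r₀≤m π′
    module B  = L.Lower q q<r₀
    module B′ = L′.Lower q′ q′<r₀

    a≡a′ : B.a ≡ B′.a
    a≡a′ = trans (sym B.σ-origin) (trans (σ≈σ′ L.origin) B′.σ-origin)

    σ′σ⁻¹ : ∀ v → B′.σ ⟨$⟩ʳ (B.σ ⟨$⟩ˡ v) ≡ v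
    σ′σ⁻¹ v = trans (sym (σ≈σ′ _)) (Perm.inverseʳ B.σ)

    E⇒E′ : ∀ v → X.E v → X′.E v
    E⇒E′ v v∈E = subst X′.E (σ′σ⁻¹ v) (B′.Excedance-σ⇒E _ (Excedance-resp r₀ B.σ B′.σ σ≈σ′ _
      (B.E⇒Excedance-σ _ (subst X.E (sym (Perm.inverseʳ B.σ)) v∈E))))

    Initial⇒ : ∀ v → L.Initial v → L′.Initial v
    Initial⇒ v init = subst L′.Initial (σ′σ⁻¹ v) (B′.σ-initial _ (LowSpecial.initial-σ⁻¹ π q q<r₀ v init))

  -- The result determines `a` as the letter at place r₀, E as its set of excedance letters, and the
  -- initial letters as those up to place r₀. These fix the rotation, hence `σ₀`, and q is the place
  -- of `a` in `σ₀`.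
  low-injective : ∀ π π′ q q′ q<r₀ q′<r₀ → Low.Lower.σ r₀ m r₀≤m π q q<r₀ ≈ Low.Lower.σ r₀ m r₀≤m π′ q′ q′<r₀ →
                  π ≈ π′ × q ≡ q′
  low-injective π π′ q q′ q<r₀ q′<r₀ σ≈σ′ =
    high-injective π π′ L.origin _ _ σ₀≈σ₀′ ,
    ⟨$⟩ʳ-injective L.σ₀ (trans a≡a′ (sym (σ₀≈σ₀′ q′)))
    where
    open LowPair π π′ q q′ q<r₀ q′<r₀ σ≈σ′
    module Back = LowPair π′ π q′ q q′<r₀ q<r₀ (λ i → sym (σ≈σ′ i))
    K≗K′ : ∀ v → X.K v ≡ X′.K v
    K≗K′ v with toSum (X.E? v)
    ... | inj₁ v∈E = trans (X.K-E v v∈E) (sym (X′.K-E v (E⇒E′ v v∈E)))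
    ... | inj₂ v∉E = trans (X.K-¬E v v∉E) (sym (X′.K-¬E v (v∉E ∘ Back.E⇒E′ v)))
    σ₀≈σ₀′ : L.σ₀ ≈ L′.σ₀
    σ₀≈σ₀′ i = B.Sₗ-functional (B.σ-Rotates i)
      (subst₂ (λ t u → Rotates B.Sₗ X.K t u (L′.σ₀ ⟨$⟩ʳ i)) (sym a≡a′) (sym (σ≈σ′ i))
        (Rotates-resp
          (λ v (init , le) → Back.Initial⇒ v init , subst₂ _≤_ (sym (K≗K′ v)) (trans (sym (K≗K′ _)) (cong X.K (sym a≡a′))) le)
          (λ v (init , le) → Initial⇒ v init , subst₂ _≤_ (K≗K′ v) (trans (K≗K′ _) (cong X′.K a≡a′)) le)
          (sym ∘ K≗K′) (B′.σ-Rotates i)))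

-- `π ≈ ρ` is not an equality of records, so `den` is evaluated on both sides with the same decision
-- procedure for excedances, after which only letters are compared.
den-cong : ∀ r₀ (π ρ : Permutation′ n) → π ≈ ρ → den (suc r₀) π ≡ den (suc r₀) ρ
den-cong {n} r₀ π ρ π≈ρ = begin
  den (suc r₀) π
    ≡⟨ den-inversions r₀ π n ℕ.≤-refl E? (λ _ e → e) (λ _ e → e) ⟩
  triangle (count E?) + inversions (λ j → key n (E? j) (toℕ (π ⟨$⟩ʳ j)))
    ≡⟨ cong (triangle (count E?) +_) (inversions-cong
         (λ i j → subst₂ _<_ (same j) (same i)) (λ i j → subst₂ _<_ (sym (same j)) (sym (same i)))) ⟩
  triangle (count E?) + inversions (λ j → key n (E? j) (toℕ (ρ ⟨$⟩ʳ j)))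
    ≡⟨ den-inversions r₀ ρ n ℕ.≤-refl E? (Excedance-resp r₀ π ρ π≈ρ) (Excedance-resp r₀ ρ π (λ i → sym (π≈ρ i))) ⟨
  den (suc r₀) ρ ∎
  where
  open ≡-Reasoning
  E? : ∀ j → Dec (Excedance r₀ π j)
  E? j = j Fin.<? (π ⟨$⟩ʳ j) ×-dec r₀ ℕ.≤? toℕ (π ⟨$⟩ʳ j)
  same : ∀ j → key n (E? j) (toℕ (π ⟨$⟩ʳ j)) ≡ key n (E? j) (toℕ (ρ ⟨$⟩ʳ j))
  same j = cong (λ v → key n (E? j) (toℕ v)) (π≈ρ j)

-- Increments of the insertions and the bijection

module Insertion (r₀ m : ℕ) (r₀≤m : r₀ ≤ m) where
  open Recovery r₀ m r₀≤m

  -- The increments of den: below #E they come from insertions creating a fixed point, in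
  -- [#E , #E + r₀) from insertions below r₀, and the rest from insertions creating an excedance.
  module Codes (π : Permutation′ m) where
    open Enlarged r₀ m r₀≤m π

    above? : ∀ (x v : Fin (suc m)) → Dec (E v × x <ᶠ v)
    above? x v = E? v ×-dec x Fin.<? v

    data Step (x : Fin (suc m)) : ℕ → Permutation′ (suc m) → Set where
      low   : (x<r₀ : toℕ x < r₀) → Step x (count E? + count (Low.Lower.larger? r₀ m r₀≤m π x x<r₀))
                                        (Low.Lower.σ r₀ m r₀≤m π x x<r₀)
      fixed : (r₀≤x : r₀ ≤ toℕ x) → E x → Step x (count (above? x)) (At.σ x r₀≤x)
      new   : (r₀≤x : r₀ ≤ toℕ x) → ¬ E x → Step x (count (above? x) + toℕ x) (At.σ x r₀≤x)

    step : ∀ x → ∃ λ c → ∃ λ σ → Step x c σ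
    step x with toℕ x ℕ.<? r₀
    ... | yes x<r₀ = _ , _ , low x<r₀
    ... | no x≮r₀ with toSum (E? x)
    ...   | inj₁ x∈E = _ , _ , fixed (ℕ.≮⇒≥ x≮r₀) x∈E
    ...   | inj₂ x∉E = _ , _ , new (ℕ.≮⇒≥ x≮r₀) x∉E

    Step-den : ∀ {x c σ} → Step x c σ → den (suc r₀) σ ≡ den (suc r₀) π + c
    Step-den {x} (low x<r₀)       = Low.Lower.den-σ r₀ m r₀≤m π x x<r₀
    Step-den {x} (fixed r₀≤x x∈E) = InsertionStatistics.NewFixedPoint.den-σ r₀ m r₀≤m π x r₀≤x x∈E
    Step-den {x} (new r₀≤x x∉E)   = InsertionStatistics.NewExcedance.den-σ r₀ m r₀≤m π x r₀≤x x∉E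

    Step-exc : ∀ {x c σ} → Step x c σ →
               (c ≤ exc (suc r₀) π + r₀ × exc (suc r₀) σ ≡ exc (suc r₀) π)
               ⊎ (exc (suc r₀) π + r₀ < c × exc (suc r₀) σ ≡ suc (exc (suc r₀) π))
    Step-exc {x} (low x<r₀) with toSum (E? (Low.Lower.a r₀ m r₀≤m π x x<r₀))
    ... | inj₁ a∈E = inj₂ (Low.Lower.exc-bound-E r₀ m r₀≤m π x x<r₀ a∈E , Low.Lower.exc-σ-E r₀ m r₀≤m π x x<r₀ a∈E)
    ... | inj₂ a∉E = inj₁ (Low.Lower.exc-bound-¬E r₀ m r₀≤m π x x<r₀ a∉E , Low.Lower.exc-σ-¬E r₀ m r₀≤m π x x<r₀ a∉E)
    Step-exc {x} (fixed r₀≤x x∈E) = inj₁ (exc-bound , exc-σ)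
      where
      open InsertionStatistics.NewFixedPoint r₀ m r₀≤m π x r₀≤x x∈E
    Step-exc {x} (new r₀≤x x∉E) = inj₂ (exc-bound , exc-σ)
      where
      open InsertionStatistics.NewExcedance r₀ m r₀≤m π x r₀≤x x∉E

    above-bound : ∀ x → count (above? x) + toℕ x < suc m
    above-bound x = begin-strict
      count (above? x) + toℕ x
        <⟨ ℕ.+-monoʳ-< (count (above? x)) (ℕ.n<1+n (toℕ x)) ⟩
      count (above? x) + suc (toℕ x)
        ≤⟨ ℕ.+-monoˡ-≤ (suc (toℕ x)) (count-mono (above? x) (λ v → suc (toℕ x) ℕ.≤? toℕ v) (λ _ → proj₂)) ⟩
      count {suc m} (λ v → suc (toℕ x) ℕ.≤? toℕ v) + suc (toℕ x)
        ≡⟨ count-≥ {suc m} (suc (toℕ x)) (Fin.toℕ<n x) ⟩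
      suc m ∎
      where
      open ℕ.≤-Reasoning

    low-bound : ∀ x (x<r₀ : toℕ x < r₀) → count E? + count (Low.Lower.larger? r₀ m r₀≤m π x x<r₀) < count E? + r₀
    low-bound x x<r₀ = ℕ.+-monoʳ-< (count E?) (begin-strict
      count larger?
        -- Strictness: place x is before r₀, but its letter is not larger than itself.
        <⟨ count-mono-< larger? (Fin._<? origin) (λ _ → proj₁) x
             (ℕ.<-≤-trans x<r₀ (ℕ.≤-reflexive (sym toℕ-origin))) (ℕ.<-irrefl refl ∘ proj₂) ⟩
      count (Fin._<? origin) ≡⟨ count-< origin ⟩
      toℕ origin             ≡⟨ toℕ-origin ⟩
      r₀                     ∎)
      where
      open ℕ.≤-Reasoning
      open Low r₀ m r₀≤m π
      open Lower x x<r₀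

    Step-bound : ∀ {x c σ} → Step x c σ → c < suc m
    Step-bound {x} (low x<r₀) = ℕ.<-≤-trans (low-bound x x<r₀) (begin
      count E? + r₀
        ≤⟨ ℕ.+-monoˡ-≤ r₀ (count-mono E? (λ v → r₀ ℕ.≤? toℕ v) E⇒≥r₀) ⟩
      count {suc m} (λ v → r₀ ℕ.≤? toℕ v) + r₀
        ≡⟨ count-≥ {suc m} r₀ (ℕ.m≤n⇒m≤1+n r₀≤m) ⟩
      suc m ∎)
      where
      open ℕ.≤-Reasoning
    Step-bound {x} (fixed _ _) = ℕ.≤-<-trans (ℕ.m≤m+n _ (toℕ x)) (above-bound x)
    Step-bound {x} (new _ _)   = above-bound x

    fixed-bound : ∀ x → E x → count (above? x) < count E?
    fixed-bound x x∈E = count-mono-< (above? x) E? (λ _ → proj₁) x x∈E (ℕ.<-irrefl refl ∘ proj₂)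

    -- Every letter of E is above x or in [r₀, x), an interval of x - r₀ elements.
    new-bound : ∀ x → r₀ ≤ toℕ x → ¬ E x → count E? + r₀ ≤ count (above? x) + toℕ x
    new-bound x r₀≤x x∉E = begin
      count E? + r₀
        ≤⟨ ℕ.+-monoˡ-≤ r₀ (count-∪ (above? x) between? E? split) ⟩
      count (above? x) + count between? + r₀
        ≡⟨ ℕ.+-assoc (count (above? x)) _ _ ⟩
      count (above? x) + (count between? + r₀)
        ≡⟨ cong (count (above? x) +_) (count-interval r₀ x r₀≤x) ⟩
      count (above? x) + toℕ x ∎
      where
      open ℕ.≤-Reasoning
      between? : ∀ v → Dec (r₀ ≤ toℕ v × v <ᶠ x)
      between? v = r₀ ℕ.≤? toℕ v ×-dec v Fin.<? x
      split : ∀ v → E v → (E v × x <ᶠ v) ⊎ (r₀ ≤ toℕ v × v <ᶠ x)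
      split v v∈E with Fin.<-cmp v x
      ... | tri< v<x _ _  = inj₂ (E⇒≥r₀ v v∈E , v<x)
      ... | tri≈ _ refl _ = contradiction v∈E x∉E
      ... | tri> _ _ x<v  = inj₁ (v∈E , x<v)

    fixed-decreasing : ∀ x x′ → E x′ → x <ᶠ x′ → count (above? x′) < count (above? x)
    fixed-decreasing x x′ x′∈E x<x′ = count-mono-< (above? x′) (above? x)
      (λ v (v∈E , x′<v) → v∈E , ℕ.<-trans x<x′ x′<v) x′ (x′∈E , x<x′) (ℕ.<-irrefl refl ∘ proj₂)

    -- Passing from x to x′ loses only letters of E strictly between them, at most x′ - x - 1, while
    -- the place grows by x′ - x.
    new-increasing : ∀ x x′ → ¬ E x′ → x <ᶠ x′ → count (above? x) + toℕ x < count (above? x′) + toℕ x′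
    new-increasing x x′ x′∉E x<x′ = begin-strict
      count (above? x) + toℕ x
        <⟨ ℕ.+-monoʳ-< (count (above? x)) (ℕ.n<1+n (toℕ x)) ⟩
      count (above? x) + suc (toℕ x)
        ≤⟨ ℕ.+-monoˡ-≤ (suc (toℕ x)) (count-∪ (above? x′) between? (above? x) split) ⟩
      count (above? x′) + count between? + suc (toℕ x)
        ≡⟨ ℕ.+-assoc (count (above? x′)) _ _ ⟩
      count (above? x′) + (count between? + suc (toℕ x))
        ≡⟨ cong (count (above? x′) +_) (count-interval (suc (toℕ x)) x′ x<x′) ⟩
      count (above? x′) + toℕ x′ ∎
      where
      open ℕ.≤-Reasoning
      between? : ∀ v → Dec (suc (toℕ x) ≤ toℕ v × v <ᶠ x′)
      between? v = suc (toℕ x) ℕ.≤? toℕ v ×-dec v Fin.<? x′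
      split : ∀ v → E v × x <ᶠ v → (E v × x′ <ᶠ v) ⊎ (x <ᶠ v × v <ᶠ x′)
      split v (v∈E , x<v) with Fin.<-cmp v x′
      ... | tri< v<x′ _ _ = inj₂ (x<v , v<x′)
      ... | tri≈ _ refl _ = contradiction v∈E x′∉E
      ... | tri> _ _ x′<v = inj₁ (v∈E , x′<v)

    low-decreasing : ∀ x x′ (x<r₀ : toℕ x < r₀) (x′<r₀ : toℕ x′ < r₀) → K (Low.σ₀ r₀ m r₀≤m π ⟨$⟩ʳ x) < K (Low.σ₀ r₀ m r₀≤m π ⟨$⟩ʳ x′) →
      count (Low.Lower.larger? r₀ m r₀≤m π x′ x′<r₀) < count (Low.Lower.larger? r₀ m r₀≤m π x x<r₀)
    low-decreasing x x′ x<r₀ x′<r₀ lt = count-mono-< (Lower.larger? x′ x′<r₀) (Lower.larger? x x<r₀)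
      (λ i (i<o , lt′) → i<o , ℕ.<-trans lt lt′) x′
      (ℕ.<-≤-trans x′<r₀ (ℕ.≤-reflexive (sym toℕ-origin)) , lt) (ℕ.<-irrefl refl ∘ proj₂)
      where
      open Low r₀ m r₀≤m π

    code-injective : ∀ {x x′ c c′ σ σ′} → Step x c σ → Step x′ c′ σ′ → c ≡ c′ → x ≡ x′
    code-injective {x} {x′} (low x<r₀) (low x′<r₀) eq = compare (ℕ.<-cmp (K (σ₀ ⟨$⟩ʳ x)) (K (σ₀ ⟨$⟩ʳ x′)))
      where
      open Low r₀ m r₀≤m π
      compare : _ → x ≡ x′
      compare (tri< lt _ _) = contradiction (sym (ℕ.+-cancelˡ-≡ (count E?) _ _ eq)) (ℕ.<⇒≢ (low-decreasing x x′ x<r₀ x′<r₀ lt))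
      compare (tri≈ _ eq _) = ⟨$⟩ʳ-injective σ₀ (K-injective eq)
      compare (tri> _ _ gt) = contradiction (ℕ.+-cancelˡ-≡ (count E?) _ _ eq) (ℕ.<⇒≢ (low-decreasing x′ x x′<r₀ x<r₀ gt))
    code-injective {x} {x′} (fixed _ x∈E) (fixed _ x′∈E) eq with Fin.<-cmp x x′
    ... | tri< x<x′ _ _ = contradiction (sym eq) (ℕ.<⇒≢ (fixed-decreasing x x′ x′∈E x<x′))
    ... | tri≈ _ x≡x′ _ = x≡x′
    ... | tri> _ _ x′<x = contradiction eq (ℕ.<⇒≢ (fixed-decreasing x′ x x∈E x′<x))
    code-injective {x} {x′} (new _ x∉E) (new _ x′∉E) eq with Fin.<-cmp x x′
    ... | tri< x<x′ _ _ = contradiction eq (ℕ.<⇒≢ (new-increasing x x′ x′∉E x<x′))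
    ... | tri≈ _ x≡x′ _ = x≡x′
    ... | tri> _ _ x′<x = contradiction (sym eq) (ℕ.<⇒≢ (new-increasing x′ x x∉E x′<x))
    code-injective {x} {x′} (low _) (fixed _ x′∈E) eq =
      contradiction (sym eq) (ℕ.<⇒≢ (ℕ.<-≤-trans (fixed-bound x′ x′∈E) (ℕ.m≤m+n (count E?) _)))
    code-injective {x} {x′} (fixed _ x∈E) (low _) eq =
      contradiction eq (ℕ.<⇒≢ (ℕ.<-≤-trans (fixed-bound x x∈E) (ℕ.m≤m+n (count E?) _)))
    code-injective {x} {x′} (low x<r₀) (new r₀≤x′ x′∉E) eq =
      contradiction eq (ℕ.<⇒≢ (ℕ.<-≤-trans (low-bound x x<r₀) (new-bound x′ r₀≤x′ x′∉E)))
    code-injective {x} {x′} (new r₀≤x x∉E) (low x′<r₀) eq =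
      contradiction (sym eq) (ℕ.<⇒≢ (ℕ.<-≤-trans (low-bound x′ x′<r₀) (new-bound x r₀≤x x∉E)))
    code-injective {x} {x′} (fixed _ x∈E) (new r₀≤x′ x′∉E) eq =
      contradiction eq (ℕ.<⇒≢ (ℕ.<-≤-trans (fixed-bound x x∈E) (ℕ.≤-trans (ℕ.m≤m+n (count E?) r₀) (new-bound x′ r₀≤x′ x′∉E))))
    code-injective {x} {x′} (new r₀≤x x∉E) (fixed _ x′∈E) eq =
      contradiction (sym eq) (ℕ.<⇒≢ (ℕ.<-≤-trans (fixed-bound x′ x′∈E) (ℕ.≤-trans (ℕ.m≤m+n (count E?) r₀) (new-bound x r₀≤x x∉E))))

    opaque
      code : Fin (suc m) → Fin (suc m)
      code x = fromℕ< (Step-bound (proj₂ (proj₂ (step x))))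

      toℕ-code : ∀ x → toℕ (code x) ≡ proj₁ (step x)
      toℕ-code x = Fin.toℕ-fromℕ< (Step-bound (proj₂ (proj₂ (step x))))

      -- Its inverse finds the place with a prescribed increment, so that the second argument of `φ`
      -- is the increment and not the place.
      codes : Permutation′ (suc m)
      codes = injective⇒permutation code λ {x} {x′} eq →
        code-injective (proj₂ (proj₂ (step x))) (proj₂ (proj₂ (step x′)))
          (trans (sym (toℕ-code x)) (trans (cong toℕ eq) (toℕ-code x′)))

      insertion : Fin (suc m) → Permutation′ (suc m)
      insertion c = proj₁ (proj₂ (step (codes ⟨$⟩ˡ c)))

      insertion-Step : ∀ c → Step (codes ⟨$⟩ˡ c) (toℕ c) (insertion c)
      insertion-Step c = subst (λ k → Step x k (insertion c))
        (trans (sym (toℕ-code x)) (cong toℕ (Perm.inverseʳ codes {c}))) (proj₂ (proj₂ (step x)))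
        where
        x : Fin (suc m)
        x = codes ⟨$⟩ˡ c

  high-unique : ∀ π π′ x x′ r≤x r≤x′ →
    Enlarged.At.σ r₀ m r₀≤m π x r≤x ≈ Enlarged.At.σ r₀ m r₀≤m π′ x′ r≤x′ → π ≈ π′ × x ≡ x′
  high-unique π π′ x x′ r≤x r≤x′ σ≈σ′ with Fin.<-cmp x x′
  ... | tri≈ _ refl _ = high-injective π π′ x r≤x r≤x′ σ≈σ′ , refl
  ... | tri< x<x′ _ _ = contradiction
    (Special-resp (Enlarged.At.σ r₀ m r₀≤m π′ x′ r≤x′) (Enlarged.At.σ r₀ m r₀≤m π x r≤x) (λ i → sym (σ≈σ′ i)) x′ (HighSpecial.special π′ x′ r≤x′))
    (HighSpecial.not-special π x r≤x x′ x<x′)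
  ... | tri> _ _ x′<x = contradiction
    (Special-resp (Enlarged.At.σ r₀ m r₀≤m π x r≤x) (Enlarged.At.σ r₀ m r₀≤m π′ x′ r≤x′) σ≈σ′ x (HighSpecial.special π x r≤x))
    (HighSpecial.not-special π′ x′ r≤x′ x x′<x)

  low≉high : ∀ π π′ x x′ x<r₀ r≤x′ → ¬ (Low.Lower.σ r₀ m r₀≤m π x x<r₀ ≈ Enlarged.At.σ r₀ m r₀≤m π′ x′ r≤x′)
  low≉high π π′ x x′ x<r₀ r≤x′ σ≈σ′ = LowSpecial.not-special π x x<r₀ x′ r≤x′
    (Special-resp (Enlarged.At.σ r₀ m r₀≤m π′ x′ r≤x′) (Low.Lower.σ r₀ m r₀≤m π x x<r₀) (λ i → sym (σ≈σ′ i)) x′ (HighSpecial.special π′ x′ r≤x′))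

  Step-injective : ∀ {π π′ x x′ c c′ σ σ′} → Codes.Step π x c σ → Codes.Step π′ x′ c′ σ′ → σ ≈ σ′ → π ≈ π′ × x ≡ x′
  Step-injective {π} {π′} {x} {x′} (Codes.low x<r₀) (Codes.low x′<r₀) = low-injective π π′ x x′ x<r₀ x′<r₀
  Step-injective {π} {π′} {x} {x′} (Codes.low x<r₀) (Codes.fixed r≤x′ _) = ⊥-elim ∘ low≉high π π′ x x′ x<r₀ r≤x′
  Step-injective {π} {π′} {x} {x′} (Codes.low x<r₀) (Codes.new r≤x′ _) = ⊥-elim ∘ low≉high π π′ x x′ x<r₀ r≤x′
  Step-injective {π} {π′} {x} {x′} (Codes.fixed r≤x _) (Codes.low x′<r₀) σ≈σ′ = ⊥-elim (low≉high π′ π x′ x x′<r₀ r≤x (λ i → sym (σ≈σ′ i)))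
  Step-injective {π} {π′} {x} {x′} (Codes.new r≤x _) (Codes.low x′<r₀) σ≈σ′ = ⊥-elim (low≉high π′ π x′ x x′<r₀ r≤x (λ i → sym (σ≈σ′ i)))
  Step-injective {π} {π′} {x} {x′} (Codes.fixed r≤x _) (Codes.fixed r≤x′ _) = high-unique π π′ x x′ r≤x r≤x′
  Step-injective {π} {π′} {x} {x′} (Codes.fixed r≤x _) (Codes.new r≤x′ _) = high-unique π π′ x x′ r≤x r≤x′
  Step-injective {π} {π′} {x} {x′} (Codes.new r≤x _) (Codes.fixed r≤x′ _) = high-unique π π′ x x′ r≤x r≤x′
  Step-injective {π} {π′} {x} {x′} (Codes.new r≤x _) (Codes.new r≤x′ _) = high-unique π π′ x x′ r≤x r≤x′

  φ : Permutation′ m → Fin (suc m) → Permutation′ (suc m)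
  φ = Codes.insertion

  -- Once π is recovered from the shape of the result, c is the difference of the two values of
  -- `den`; the place need not be translated back.
  φ-injective : ∀ π π′ c c′ → φ π c ≈ φ π′ c′ → π ≈ π′ × c ≡ c′
  φ-injective π π′ c c′ eq = π≈π′ , Fin.toℕ-injective (ℕ.+-cancelˡ-≡ (den (suc r₀) π) _ _ (begin
    den (suc r₀) π + toℕ c   ≡⟨ Codes.Step-den π (Codes.insertion-Step π c) ⟨
    den (suc r₀) (φ π c)     ≡⟨ den-cong r₀ (φ π c) (φ π′ c′) eq ⟩
    den (suc r₀) (φ π′ c′)   ≡⟨ Codes.Step-den π′ (Codes.insertion-Step π′ c′) ⟩
    den (suc r₀) π′ + toℕ c′ ≡⟨ cong (_+ toℕ c′) (den-cong r₀ π π′ π≈π′) ⟨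
    den (suc r₀) π + toℕ c′  ∎))
    where
    open ≡-Reasoning
    π≈π′ : π ≈ π′
    π≈π′ = proj₁ (Step-injective (Codes.insertion-Step π c) (Codes.insertion-Step π′ c′) eq)

theorem1 : (r m : ℕ) → 1 ≤ r → r < suc m →
    Σ (Permutation′ m → Fin (suc m) → Permutation′ (suc m)) λ φ →
    ((π π′ : Permutation′ m) (c c′ : Fin (suc m)) →
    φ π c ≈ φ π′ c′ → (π ≈ π′) × (c ≡ c′))
    × ((σ : Permutation′ (suc m)) →
    Σ (Permutation′ m) λ π → Σ (Fin (suc m)) λ c → φ π c ≈ σ)
    × ((π : Permutation′ m) (c : Fin (suc m)) →
    ((toℕ c ≤ exc r π + r ∸ 1) → exc r (φ π c) ≡ exc r π)
    × ((exc r π + r ∸ 1 < toℕ c) → exc r (φ π c) ≡ suc (exc r π))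
    × (den r (φ π c) ≡ den r π + toℕ c))
theorem1 (suc r₀) m 1≤r (s≤s r≤m) = φ , φ-injective , insertion-surjective φ φ-injective , statistics
  where
  open Insertion r₀ m (ℕ.<⇒≤ r≤m)
  threshold : ∀ e → e + suc r₀ ∸ 1 ≡ e + r₀
  threshold e = cong (_∸ 1) (ℕ.+-suc e r₀)
  statistics : ∀ π c →
    (toℕ c ≤ exc (suc r₀) π + suc r₀ ∸ 1 → exc (suc r₀) (φ π c) ≡ exc (suc r₀) π)
    × (exc (suc r₀) π + suc r₀ ∸ 1 < toℕ c → exc (suc r₀) (φ π c) ≡ suc (exc (suc r₀) π))
    × den (suc r₀) (φ π c) ≡ den (suc r₀) π + toℕ c
  statistics π c with step ← Codes.insertion-Step π c with Codes.Step-exc π step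
  ... | inj₁ (c≤ , same) = (λ _ → same) ,
    (λ c> → contradiction (subst (_< toℕ c) (threshold _) c>) (ℕ.≤⇒≯ c≤)) , Codes.Step-den π step
  ... | inj₂ (c> , more) =
    (λ c≤ → contradiction (subst (toℕ c ≤_) (threshold _) c≤) (ℕ.<⇒≱ c>)) , (λ _ → more) , Codes.Step-den π step
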